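{- Let $\underline{h}=(h_0,h_1,\dots,h_e)$ be a finite $O$-sequence. Then $\underline{h}$ is the "first half" of a pure $O$-sequence (i.e. there exists a pure $O$-sequence $(H_0,H_1,\dots,H_E)$ with $\lfloor E/2\rfloor=e$ and $H_i=h_i$ for all $0\le i\le e$) if and only if $\underline{h}$ is differentiable.
   Context: For a positive integer $n$ and positive integer $d$, write $n=\binom{k_d}{d}+\binom{k_{d-1}}{d-1}+\cdots+\binom{k_\delta}{\delta}$ with $k_d>k_{d-1}>\dots>k_\delta\ge\delta\ge1$ (the unique $d$-binomial expansion), and set $(n_{(d)})^b_a=\binom{k_d+b}{d+a}+\cdots+\binom{k_\delta+b}{\delta+a}$, with $\binom{m}{p}=0$ if $p<0$ or $m<p$; set $(0_{(d)})^b_a=0$. A sequence $(h_0,\dots,h_e)$ of non-negative integers with $h_0=1$ is an $O$-sequence if $h_{d+1}\le ((h_d)_{(d)})^1_1$ for all $1\le d<e$ (equivalently, it is the Hilbert function of a standard graded algebra). A monomial order ideal is a finite nonempty set $X$ of monomials in some variables such that whenever $M\in X$ and $N\mid M$ then $N\in X$; it is pure if all maximal monomials (under divisibility) have the same degree $e$ (the socle degree). A pure $O$-sequence is the vector $(h_0,\dots,h_e)$ where $h_i$ is the number of monomials of degree $i$ in a pure monomial order ideal of socle degree $e$. A sequence $(h_0,\dots,h_e)$ is differentiable if $(h_0,h_1-h_0,h_2-h_1,\dots,h_e-h_{e-1})$ is an $O$-sequence. -}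

module Defs where

open import Data.Nat using (ℕ; zero; suc; _+_; _∸_; _≤_; _<_; _≤ᵇ_; _≟_; _/_)
open import Data.Nat.Combinatorics using (_C_)
open import Data.Bool using (if_then_else_)
open import Data.Fin using (Fin)
open import Data.Vec using (Vec; lookup; toList)
import Data.Vec as Vec
open import Data.List using (List; []; length; filter)
import Data.List as List
open import Data.List.Membership.Propositional using (_∈_)
open import Data.List.Relation.Unary.Unique.Propositional using (Unique)
open import Data.Product using (Σ; _×_; ∃-syntax)
open import Relation.Binary.PropositionalEquality using (_≡_; _≢_)

findK : ℕ → ℕ → ℕ → ℕ
findK d n zero    = zero
findK d n (suc b) = if (suc b) C d ≤ᵇ n then suc b else findK d n (b)

-- The d-binomial expansion n = C(k_d,d) + ... + C(k_δ,δ) is computed greedily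
-- (k_d = largest k with C(k,d) ≤ n, then expand the remainder in degree d-1,
-- stopping when the remainder is 0); this is the unique d-binomial expansion.
-- macaulayBound d n = (n_(d))^1_1 = C(k_d+1,d+1) + ... + C(k_δ+1,δ+1),
-- and macaulayBound d 0 = 0.
macaulayBound : ℕ → ℕ → ℕ
macaulayBound zero    n       = zero
macaulayBound (suc d) zero    = zero
macaulayBound (suc d) (suc m) =
  let n = suc m
      k = findK (suc d) n (n + suc d)
  in  (suc k) C (suc (suc d)) + macaulayBound d (n ∸ k C (suc d))

-- Sequences (h_0,…,h_e) are vectors of length e+1; `get` reads entry i
-- (only ever used with i ≤ e).

getL : List ℕ → ℕ → ℕ
getL []             i       = zero
getL (x List.∷ xs)  zero    = x
getL (x List.∷ xs)  (suc i) = getL xs i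

get : ∀ {n} → Vec ℕ n → ℕ → ℕ
get h i = getL (toList h) i

IsOSequence : ∀ {e} → Vec ℕ (suc e) → Set
IsOSequence {e} h =
  get h 0 ≡ 1 × (∀ d → 1 ≤ d → d < e → get h (suc d) ≤ macaulayBound d (get h d))

Δ : ∀ {e} → Vec ℕ (suc e) → Vec ℕ (suc e)
Δ {e} h = Vec.tabulate (λ (i : Fin (suc e)) → go (Data.Fin.toℕ i))
  where
  go : ℕ → ℕ
  go zero    = get h 0
  go (suc i) = get h (suc i) ∸ get h i

-- differentiable: the difference sequence consists of non-negative integers
-- (h_{i-1} ≤ h_i) and is an O-sequence
Differentiable : ∀ {e} → Vec ℕ (suc e) → Set
Differentiable {e} h = (∀ i → i < e → get h i ≤ get h (suc i)) × IsOSequence (Δ h)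

-- Monomials in r variables = exponent vectors

Monomial : ℕ → Set
Monomial r = Vec ℕ r

_∣ₘ_ : ∀ {r} → Monomial r → Monomial r → Set
N ∣ₘ M = ∀ i → lookup N i ≤ lookup M i

deg : ∀ {r} → Monomial r → ℕ
deg M = Vec.sum M

IsOrderIdeal : ∀ {r} → List (Monomial r) → Set
IsOrderIdeal {r} X = Unique X × X ≢ [] × (∀ M N → M ∈ X → N ∣ₘ M → N ∈ X)

IsMaximal : ∀ {r} → List (Monomial r) → Monomial r → Set
IsMaximal X M = M ∈ X × (∀ N → N ∈ X → M ∣ₘ N → N ≡ M)

IsPureOrderIdeal : ∀ {r} → List (Monomial r) → ℕ → Set
IsPureOrderIdeal X E = IsOrderIdeal X × (∀ M → IsMaximal X M → deg M ≡ E)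

countDeg : ∀ {r} → List (Monomial r) → ℕ → ℕ
countDeg X i = length (filter (λ M → deg M ≟ i) X)

IsPureOSequence : ∀ {E} → Vec ℕ (suc E) → Set
IsPureOSequence {E} H =
  ∃[ r ] Σ (List (Monomial r)) λ X →
    IsPureOrderIdeal X E × (∀ (i : Fin (suc E)) → countDeg X (Data.Fin.toℕ i) ≡ lookup H i)

IsFirstHalfOfPure : ∀ {e} → Vec ℕ (suc e) → Set
IsFirstHalfOfPure {e} h =
  ∃[ E ] Σ (Vec ℕ (suc E)) λ H →
    IsPureOSequence H × E / 2 ≡ e × (∀ i → i ≤ e → get H i ≡ get h i)

{-# OPTIONS --safe #-}

-- Let X be a pure order ideal of socle degree E.  Multiplication by the sum ℓ of the variables is
-- injective in degrees d < E/2 on the monomial algebra A with basis X (Hausel): a form killed by ℓ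
-- is killed by ℓ in k[x]/(x₁^(a₁+1),…) for every maximal monomial x^a of X, where the sl₂-relation
-- DU - UD = E - 2d forces it to vanish.  Hence the first half of Δh counts the standard monomials
-- of A/ℓA.  These form an order ideal, and Macaulay's theorem bounds its growth.
-- Macaulay's theorem is proved by induction on the number of variables: dehomogenise, compress to
-- an order ideal, and apply the theorem to its homogeneous parts.
--
-- Conversely, let Γ consist of the first Δhᵢ monomials of degree i in lexicographic order.  By
-- Macaulay's condition it is an order ideal.  The monomials z^j M with M in Γ and j + deg M ≤ 2e
-- form a pure order ideal whose i-th entry is Δh₀ + … + Δhᵢ = hᵢ for i ≤ e.
module Submission where

open import Defs
open import Data.Nat using (ℕ; suc)
open import Data.Vec using (Vec)
open import Data.Product using (_×_; _,_)

-- Coefficients are integers: the sl₂ argument needs a positive integer to act injectively, and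
-- dimensions are compared only through nontrivial linear relations, for which an integral domain is
-- enough. No quotient algebra is formed. A form is a function on all monomials and its class in A
-- is its restriction to `X`; since `X` is closed under divisors, `U` respects this restriction. The
-- growth bound is proved for words instead of binomial expansions: if a family has more than
-- `rank 0 (t ∷ ts)` monomials, its shadow has more than `rank 0 ts`. Removing a letter or lowering
-- all letters stays within this form, whereas an expansion would have to be normalised again after
-- each such step. The bound on Δh in degree d + 2 rests on injectivity in degree d: this limits the
-- standard monomials of degree d + 1 from above, while in degree d + 2 it is enough that the image
-- of ℓ is no larger than its source.

module Macaulay where

  open import Data.Nat
  open import Data.Nat.Properties
  open import Data.Nat.Combinatorics using (_C_; nCn≡1; nC1≡n; nCk≡nC[n∸k]; k>n⇒nCk≡0; nCk+nC[k+1]≡[n+1]C[k+1])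
  open import Data.Nat.Induction using (<-wellFounded)
  open import Data.Nat.Tactic.RingSolver using (solve-∀)
  open import Data.Bool using (Bool; true; false; _∧_; T)
  open import Data.Bool.Properties using (T-≡)
  open import Data.Fin using (Fin; zero; suc; punchIn)
  import Data.Fin as Fin
  import Data.Fin.Properties as Fin
  open import Data.List using (List; []; _∷_; _++_; length; map)
  open import Data.List.Properties using (length-++; length-map)
  open import Data.Vec using (Vec; []; _∷_; lookup; updateAt; insertAt; removeAt)
  open import Data.Vec.Properties using (insertAt-lookup; insertAt-removeAt; removeAt-insertAt)
  open import Data.Product using (_×_; _,_; proj₁; proj₂; ∃-syntax)
  open import Data.Sum using (_⊎_; inj₁; inj₂)
  open import Data.Empty using (⊥-elim)
  open import Data.Unit using (tt)
  open import Function.Bundles using (Equivalence)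
  open import Induction.WellFounded using (Acc; acc)
  open import Relation.Nullary using (Dec; yes; no; contradiction)
  open import Relation.Binary.PropositionalEquality

  -- Binomial coefficients and greedy expansions.

  nC0≡1 : ∀ n → n C 0 ≡ 1
  nC0≡1 n = trans (nCk≡nC[n∸k] {0} {n} z≤n) (nCn≡1 n)

  pascal : ∀ n k → suc n C suc k ≡ n C suc k + n C k
  pascal n k = trans (sym (nCk+nC[k+1]≡[n+1]C[k+1] n k)) (+-comm (n C k) _)

  C-monoˡ-≤ : ∀ k {m n} → m ≤ n → m C k ≤ n C k
  C-monoˡ-≤ k m≤n = go k (≤⇒≤′ m≤n)
    where
    C-suc : ∀ k n → n C k ≤ suc n C k
    C-suc zero    n = ≤-reflexive (trans (nC0≡1 n) (sym (nC0≡1 (suc n))))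
    C-suc (suc k) n = ≤-trans (m≤m+n _ _) (≤-reflexive (sym (pascal n k)))
    go : ∀ k {m n} → m ≤′ n → m C k ≤ n C k
    go k ≤′-refl       = ≤-refl
    go k (≤′-step m≤n) = ≤-trans (go k m≤n) (C-suc k _)

  nC[1+n]≡0 : ∀ n → n C suc n ≡ 0
  nC[1+n]≡0 n = k>n⇒nCk≡0 {n} {suc n} ≤-refl

  -- `Expansion n d c b`: c = C(k_d,d) + … + C(k_1,1) and b = C(k_d+1,d+1) + … + C(k_1+1,2), where
  -- k_i = x_i + i - 1 with n > x_d ≥ … ≥ x_1 ≥ 0.  The x_i are the variables of the c-th monomial
  -- of degree d in lexicographic order; unlike in the paper the vanishing terms (x_i = 0) are kept.
  data Expansion : (n d c b : ℕ) → Set where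
    []  : ∀ {n} → Expansion n 0 0 0
    _∷_ : ∀ {n x d c b} → x < n → Expansion (suc x) d c b →
          Expansion n (suc d) ((x + d) C (suc d) + c) ((x + suc d) C (suc (suc d)) + b)

  Expansion-mono : ∀ {m n d c b} → m ≤ n → Expansion m d c b → Expansion n d c b
  Expansion-mono m≤n []        = []
  Expansion-mono m≤n (x<m ∷ ε) = <-≤-trans x<m m≤n ∷ ε

  -- Pascal's rule makes the terms telescope from the lowest one upwards. Since `(n + d) C d` counts
  -- the monomials of degree `d` in `n + 1` variables, `c` is a position among them; the estimate is
  -- also what forces the greedy choice.
  value-< : ∀ {n d c b} → Expansion (suc n) d c b → c < (n + d) C d
  value-< {n} [] = ≤-reflexive (sym (nC0≡1 (n + 0)))
  value-< {n} (_∷_ {x = x} {d} {c} x<n ε) = begin-strict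
    (x + d) C (suc d) + c           <⟨ +-monoʳ-< _ (value-< ε) ⟩
    (x + d) C (suc d) + (x + d) C d ≡⟨ pascal (x + d) d ⟨
    suc (x + d) C (suc d)           ≡⟨ cong (_C suc d) (+-suc x d) ⟨
    (x + suc d) C (suc d)           ≤⟨ C-monoˡ-≤ (suc d) (+-monoˡ-≤ (suc d) (s≤s⁻¹ x<n)) ⟩
    (n + suc d) C (suc d)           ∎
    where open ≤-Reasoning

  bound-< : ∀ {n d c b} → Expansion (suc n) d c b → b < (n + suc d) C (suc d)
  bound-< {n} [] = ≤-trans (s≤s z≤n) (≤-reflexive (sym (trans (nC1≡n (n + 1)) (+-comm n 1))))
  bound-< {n} (_∷_ {x = x} {d} {c} {b} x<n ε) = begin-strict
    (x + suc d) C (suc (suc d)) + b                   <⟨ +-monoʳ-< _ (bound-< ε) ⟩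
    (x + suc d) C (suc (suc d)) + (x + suc d) C suc d ≡⟨ pascal (x + suc d) (suc d) ⟨
    suc (x + suc d) C (suc (suc d))                   ≡⟨ cong (_C suc (suc d)) (+-suc x (suc d)) ⟨
    (x + suc (suc d)) C (suc (suc d))                 ≤⟨ C-monoˡ-≤ (suc (suc d)) (+-monoˡ-≤ (suc (suc d)) (s≤s⁻¹ x<n)) ⟩
    (n + suc (suc d)) C (suc (suc d))                 ∎
    where open ≤-Reasoning

  findK-unique : ∀ d n k b → k C d ≤ n → n < suc k C d → k ≤ b → findK d n b ≡ k
  findK-unique d n k zero    lo hi z≤n = refl
  findK-unique d n k (suc b) lo hi k≤ with suc b C d ≤ᵇ n in eq
  ... | true  = ≤-antisym (≮⇒≥ λ k<b → <⇒≱ hi (≤-trans (C-monoˡ-≤ d k<b) (≤ᵇ⇒≤ _ _ (subst T (sym eq) tt)))) k≤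
  ... | false = findK-unique d n k b lo hi (s≤s⁻¹ (≤∧≢⇒< k≤ λ { refl → subst T eq (≤⇒≤ᵇ lo) }))

  m<[m+1+d]C[1+d] : ∀ m d → m < (m + suc d) C suc d
  m<[m+1+d]C[1+d] zero    d = ≤-reflexive (sym (nCn≡1 (suc d)))
  m<[m+1+d]C[1+d] (suc m) d = begin-strict
    suc m                                       ≡⟨ +-comm m 1 ⟨
    m + 1                                       <⟨ +-mono-<-≤ (m<[m+1+d]C[1+d] m d) (≤-trans (≤-reflexive (sym (nCn≡1 d))) (C-monoˡ-≤ d (≤-trans (n≤1+n d) (m≤n+m (suc d) m)))) ⟩
    (m + suc d) C suc d + (m + suc d) C d       ≡⟨ pascal (m + suc d) d ⟨
    (suc m + suc d) C suc d                     ∎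
    where open ≤-Reasoning

  -- The tail is smaller than the gap between `k C suc d` and `suc k C suc d`, where `k = x + d`. So
  -- the search finds exactly this `k`, and what remains after subtraction is the tail.
  macaulayBound≡bound : ∀ {n d c b} → Expansion n d c b → macaulayBound d c ≡ b
  macaulayBound≡bound [] = refl
  -- All terms vanish here: the tail is below `d C d`, which is 1, so the value is 0 and the greedy
  -- algorithm stops.
  macaulayBound≡bound (_∷_ {x = zero} {d} {c} {b} x<n ε) = begin
    macaulayBound (suc d) (d C suc d + c) ≡⟨ cong (macaulayBound (suc d)) (cong₂ _+_ (nC[1+n]≡0 d) c≡0) ⟩
    0                                     ≡⟨ cong₂ _+_ (nC[1+n]≡0 (suc d)) b≡0 ⟨
    suc d C suc (suc d) + b               ∎
    where
    open ≡-Reasoning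
    c≡0 : c ≡ 0
    c≡0 = n<1⇒n≡0 (subst (c <_) (nCn≡1 d) (value-< ε))
    b≡0 : b ≡ 0
    b≡0 = n<1⇒n≡0 (subst (b <_) (nCn≡1 (suc d)) (bound-< ε))
  macaulayBound≡bound (_∷_ {x = suc x} {d} {c} {b} x<n ε) = step ((suc x + d) C suc d + c) refl
    where
    k = suc x + d
    value<next : k C suc d + c < suc k C suc d
    value<next = subst (k C suc d + c <_) (sym (pascal k d)) (+-monoʳ-< _ (value-< ε))
    positive : 1 ≤ k C suc d
    positive = ≤-trans (≤-reflexive (sym (nCn≡1 (suc d)))) (C-monoˡ-≤ (suc d) (s≤s (m≤n+m d x)))
    step : ∀ v → v ≡ k C suc d + c → macaulayBound (suc d) v ≡ (suc x + suc d) C suc (suc d) + b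
    step zero v≡ = ⊥-elim (<⇒≱ positive (≤-trans (m≤m+n _ c) (≤-reflexive (sym v≡))))
    step (suc v) v≡ = cong₂ _+_
      (cong (_C suc (suc d)) (trans (cong suc found) (sym (+-suc (suc x) d))))
      (trans (cong (macaulayBound d) (trans (cong₂ (λ s t → s ∸ t C suc d) v≡ found) (m+n∸m≡n (k C suc d) c)))
             (macaulayBound≡bound ε))
      where
      found : findK (suc d) (suc v) (suc v + suc d) ≡ k
      -- x < C(k,d+1) ≤ v, so the search of findK starts high enough.
      found = findK-unique (suc d) (suc v) k (suc v + suc d)
        (≤-trans (m≤m+n _ c) (≤-reflexive (sym v≡)))
        (subst (_< suc k C suc d) (sym v≡) value<next)
        (+-mono-≤ {x = suc x} (≤-trans (subst (λ l → x < l C suc d) (+-suc x d) (m<[m+1+d]C[1+d] x d)) (≤-trans (m≤m+n _ c) (≤-reflexive (sym v≡)))) (n≤1+n d))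

  -- The largest admissible leading variable is `n`. If its term fits into `c`, Pascal's rule keeps
  -- the remainder in range; if not, `c` is already in range for a smaller `n`.
  expand : ∀ n d c → c < (n + d) C d → ∃[ b ] Expansion (suc n) d c b
  expand n zero c c< with refl ← n<1⇒n≡0 {c} (subst (c <_) (nC0≡1 (n + 0)) c<) = 0 , []
  expand n (suc d) c c< with (n + d) C suc d ≤? c
  ... | yes le = _ , subst (λ v → Expansion (suc n) (suc d) v ((n + suc d) C suc (suc d) + proj₁ rest)) (m+[n∸m]≡n le) (≤-refl ∷ proj₂ rest)
    where
    rest : ∃[ b ] Expansion (suc n) d (c ∸ (n + d) C suc d) b
    rest = expand n d _ (+-cancelˡ-< ((n + d) C suc d) _ _ (begin-strict
      (n + d) C suc d + (c ∸ (n + d) C suc d) ≡⟨ m+[n∸m]≡n le ⟩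
      c                                       <⟨ c< ⟩
      (n + suc d) C suc d                     ≡⟨ cong (_C suc d) (+-suc n d) ⟩
      suc (n + d) C suc d                     ≡⟨ pascal (n + d) d ⟩
      (n + d) C suc d + (n + d) C d           ∎))
      where open ≤-Reasoning
  expand zero (suc d) c c< | no gt = ⊥-elim (gt (subst (_≤ c) (sym (nC[1+n]≡0 d)) z≤n))
  expand (suc n) (suc d) c c< | no gt with expand n (suc d) c (subst (λ k → c < k C suc d) (sym (+-suc n d)) (≰⇒> gt))
  ... | b , ε = b , Expansion-mono (n≤1+n _) ε

  -- The rank of a monomial x_{t_1} ⋯ x_{t_D}, given as the list of its variables with the smallest
  -- index first, is `rank 0`; `rank 1` is the rank of its product with x_0.
  rank : ℕ → List ℕ → ℕ
  rank p []       = 0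
  rank p (t ∷ ts) = (t + p) C suc p + rank (suc p) ts

  rank-snoc : ∀ p ts t → rank p (ts ++ t ∷ []) ≡ (t + (p + length ts)) C suc (p + length ts) + rank p ts
  rank-snoc p []       t = cong (λ q → (t + q) C suc q + 0) (sym (+-identityʳ p))
  rank-snoc p (s ∷ ts) t rewrite rank-snoc (suc p) ts t | +-suc p (length ts) =
    lemma ((s + p) C suc p) ((t + suc (p + length ts)) C (suc (suc (p + length ts)))) (rank (suc p) ts)
    where
    lemma : ∀ a b c → a + (b + c) ≡ b + (a + c)
    lemma = solve-∀

  Expansion⇒word : ∀ {n d c b} → Expansion n d c b → ∃[ w ] length w ≡ d × rank 0 w ≡ c × rank 1 w ≡ b
  Expansion⇒word [] = [] , refl , refl , refl
  Expansion⇒word (_∷_ {x = x} x<n ε) with Expansion⇒word ε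
  ... | w , refl , refl , refl = w ++ x ∷ [] , trans (length-++ w) (+-comm (length w) 1) , rank-snoc 0 w x , rank-snoc 1 w x

  -- Pascal's rule letter by letter, a letter 0 contributing nothing on either side. At `p = 0` it
  -- sorts the predecessors of `x_0 w` by divisibility by `x_0`: the divisible ones are `x_0` times
  -- the predecessors of `w`, the others use only variables of index at least 1.
  rank-split : ∀ p ts → rank (suc p) ts ≡ rank (suc p) (map pred ts) + rank p ts
  rank-split p []           = refl
  rank-split p (zero ∷ ts)
    rewrite nC[1+n]≡0 (suc p) | nC[1+n]≡0 p = rank-split (suc p) ts
  rank-split p (suc t ∷ ts) = begin
    (suc t + suc p) C suc (suc p) + rank (suc (suc p)) ts
      ≡⟨ cong₂ _+_ (pascal (t + suc p) (suc p)) (rank-split (suc p) ts) ⟩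
    (A + (t + suc p) C suc p) + (B + rank (suc p) ts)
      ≡⟨ cong (λ k → (A + k C suc p) + (B + rank (suc p) ts)) (+-suc t p) ⟩
    (A + suc (t + p) C suc p) + (B + rank (suc p) ts)
      ≡⟨ lemma A (suc (t + p) C suc p) B (rank (suc p) ts) ⟩
    (A + B) + (suc (t + p) C suc p + rank (suc p) ts) ∎
    where
    open ≡-Reasoning
    A = (t + suc p) C suc (suc p)
    B = rank (suc (suc p)) (map pred ts)
    lemma : ∀ a b c d → a + b + (c + d) ≡ a + c + (b + d)
    lemma = solve-∀

  -- By `rank-split`, `rank 0 (t ∷ ts)` exceeds `rank 0 (map pred (t ∷ ts)) + rank 0 ts` by
  -- `t ∸ pred t`, which is 0 or 1. This lemma and `rank-lower` are the two halves of that.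
  rank-upper : ∀ t ts → rank 0 (t ∷ ts) ≤ suc (rank 0 (map pred (t ∷ ts)) + rank 0 ts)
  rank-upper t ts = begin
    (t + 0) C 1 + rank 1 ts                          ≡⟨ cong₂ _+_ (nC1≡n (t + 0)) (rank-split 0 ts) ⟩
    t + 0 + (rank 1 (map pred ts) + rank 0 ts)       ≤⟨ +-monoˡ-≤ _ (+-monoˡ-≤ 0 (≤suc-pred t)) ⟩
    suc (pred t + 0) + (rank 1 (map pred ts) + rank 0 ts) ≡⟨ cong suc (+-assoc (pred t + 0) _ _) ⟨
    suc (pred t + 0 + rank 1 (map pred ts) + rank 0 ts)   ≡⟨ cong (λ z → suc (z + rank 1 (map pred ts) + rank 0 ts)) (nC1≡n (pred t + 0)) ⟨
    suc (rank 0 (map pred (t ∷ ts)) + rank 0 ts)     ∎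
    where
    open ≤-Reasoning
    ≤suc-pred : ∀ t → t ≤ suc (pred t)
    ≤suc-pred zero    = z≤n
    ≤suc-pred (suc t) = ≤-refl

  rank-lower : ∀ t ts → rank 0 (map pred (t ∷ ts)) + rank 0 ts ≤ rank 0 (t ∷ ts)
  rank-lower t ts = begin
    (pred t + 0) C 1 + rank 1 (map pred ts) + rank 0 ts   ≡⟨ +-assoc ((pred t + 0) C 1) _ _ ⟩
    (pred t + 0) C 1 + (rank 1 (map pred ts) + rank 0 ts) ≡⟨ cong ((pred t + 0) C 1 +_) (rank-split 0 ts) ⟨
    (pred t + 0) C 1 + rank 1 ts                          ≤⟨ +-monoˡ-≤ (rank 1 ts) (C-monoˡ-≤ 1 (+-monoˡ-≤ 0 (pred[n]≤n {t}))) ⟩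
    (t + 0) C 1 + rank 1 ts                               ∎
    where open ≤-Reasoning

  -- Finite sums and counting with Boolean predicates.

  ⟦_⟧ : Bool → ℕ
  ⟦ true ⟧  = 1
  ⟦ false ⟧ = 0

  ⟦⟧-mono : ∀ {a b} → (a ≡ true → b ≡ true) → ⟦ a ⟧ ≤ ⟦ b ⟧
  ⟦⟧-mono {false} a⇒b = z≤n
  ⟦⟧-mono {true}  a⇒b = ≤-reflexive (sym (cong ⟦_⟧ (a⇒b refl)))

  <ᵇ-true : ∀ {m n} → m < n → (m <ᵇ n) ≡ true
  <ᵇ-true m<n = Equivalence.to T-≡ (<⇒<ᵇ m<n)

  <ᵇ-true⁻ : ∀ m {n} → (m <ᵇ n) ≡ true → m < n
  <ᵇ-true⁻ m {n} eq = <ᵇ⇒< m n (Equivalence.from T-≡ eq)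

  ∧-true : ∀ {a b} → a ≡ true → b ≡ true → (a ∧ b) ≡ true
  ∧-true refl refl = refl

  ∧-true⁻ˡ : ∀ {a b} → (a ∧ b) ≡ true → a ≡ true
  ∧-true⁻ˡ {true} _ = refl

  ∧-true⁻ʳ : ∀ {a b} → (a ∧ b) ≡ true → b ≡ true
  ∧-true⁻ʳ {true} eq = eq

  sumTo : ℕ → (ℕ → ℕ) → ℕ
  sumTo zero    f = 0
  sumTo (suc k) f = f k + sumTo k f

  sumTo-mono : ∀ k {f g} → (∀ b → f b ≤ g b) → sumTo k f ≤ sumTo k g
  sumTo-mono zero    f≤g = z≤n
  sumTo-mono (suc k) f≤g = +-mono-≤ (f≤g k) (sumTo-mono k f≤g)

  sumTo-cong : ∀ k {f g} → (∀ b → f b ≡ g b) → sumTo k f ≡ sumTo k g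
  sumTo-cong zero    f≡g = refl
  sumTo-cong (suc k) f≡g = cong₂ _+_ (f≡g k) (sumTo-cong k f≡g)

  +-interchange : ∀ a b c d → a + b + (c + d) ≡ a + c + (b + d)
  +-interchange = solve-∀

  sumTo-+ : ∀ k f g → sumTo k (λ b → f b + g b) ≡ sumTo k f + sumTo k g
  sumTo-+ zero    f g = refl
  sumTo-+ (suc k) f g = trans (cong (f k + g k +_) (sumTo-+ k f g)) (+-interchange (f k) (g k) _ _)

  sumTo-zero : ∀ k → sumTo k (λ _ → 0) ≡ 0
  sumTo-zero zero    = refl
  sumTo-zero (suc k) = sumTo-zero k

  sumTo-swap : ∀ k l (f : ℕ → ℕ → ℕ) → sumTo k (λ a → sumTo l (f a)) ≡ sumTo l (λ b → sumTo k (λ a → f a b))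
  sumTo-swap zero    l f = sym (sumTo-zero l)
  sumTo-swap (suc k) l f = trans (cong (sumTo l (f k) +_) (sumTo-swap k l f)) (sym (sumTo-+ l (f k) _))

  term≤sumTo : ∀ k f {b} → b < k → f b ≤ sumTo k f
  term≤sumTo (suc k) f {b} b<k with b ≟ k
  ... | yes refl = m≤m+n _ _
  ... | no  b≢k  = ≤-trans (term≤sumTo k f (≤∧≢⇒< (s≤s⁻¹ b<k) b≢k)) (m≤n+m _ (f k))

  sumTo-extend : ∀ {k l} f → k ≤ l → sumTo k f ≤ sumTo l f
  sumTo-extend f k≤l = go (≤⇒≤′ k≤l)
    where
    go : ∀ {k l} → k ≤′ l → sumTo k f ≤ sumTo l f
    go ≤′-refl       = ≤-refl
    go (≤′-step k≤l) = ≤-trans (go k≤l) (m≤n+m _ _)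

  squeeze : ∀ {a b c d} → a ≤ b → c ≤ d → b + d ≤ a + c → b ≤ a × d ≤ c
  squeeze {a} {b} {c} {d} a≤b c≤d le =
    +-cancelʳ-≤ c b a (≤-trans (+-monoʳ-≤ b c≤d) le) , +-cancelˡ-≤ a d c (≤-trans (+-monoˡ-≤ d a≤b) le)

  sumTo-squeeze : ∀ k {f g} → (∀ b → f b ≤ g b) → sumTo k g ≤ sumTo k f → ∀ {b} → b < k → g b ≤ f b
  sumTo-squeeze (suc k) f≤g le {b} b<k with squeeze (f≤g k) (sumTo-mono k f≤g) le | b ≟ k
  ... | top , rest | yes refl = top
  ... | top , rest | no  b≢k  = sumTo-squeeze k f≤g rest (≤∧≢⇒< (s≤s⁻¹ b<k) b≢k)

  count : ℕ → (ℕ → Bool) → ℕ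
  count k P = sumTo k (λ b → ⟦ P b ⟧)

  count≤ : ∀ k P → count k P ≤ k
  count≤ zero    P = z≤n
  count≤ (suc k) P with P k
  ... | true  = s≤s (count≤ k P)
  ... | false = m≤n⇒m≤1+n (count≤ k P)

  count-full : ∀ k P → k ≤ count k P → ∀ {b} → b < k → P b ≡ true
  count-full (suc k) P full {b} b<k with P k in eq | b ≟ k
  ... | true  | yes refl = eq
  ... | true  | no  b≢k  = count-full k P (s≤s⁻¹ full) (≤∧≢⇒< (s≤s⁻¹ b<k) b≢k)
  ... | false | _        = ⊥-elim (<⇒≱ full (count≤ k P))

  count-truncate : ∀ k t P → (∀ b → P b ≡ true → b < t) → count k P ≤ count t P
  count-truncate zero    t P P<t = z≤n
  count-truncate (suc k) t P P<t with P k in eq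
  ... | true  = subst (λ x → x + count k P ≤ count t P) (cong ⟦_⟧ eq) (sumTo-extend _ (P<t k eq))
  ... | false = count-truncate k t P P<t

  count-at-most-one : ∀ k P a → (∀ b → P b ≡ true → b ≡ a) → count k P ≤ ⟦ P a ⟧
  count-at-most-one zero    P a unique = z≤n
  count-at-most-one (suc k) P a unique with P k in eq
  ... | false = count-at-most-one k P a unique
  ... | true with refl ← unique k eq rewrite eq = ≤-reflexive (cong suc (empty k ≤-refl))
    where
    empty : ∀ j → j ≤ k → count j P ≡ 0
    empty zero    _ = refl
    empty (suc j) j<k with P j in eqj
    ... | true  = ⊥-elim (<-irrefl (unique j eqj) j<k)
    ... | false = empty j (<⇒≤ j<k)

  sumTo-initial : ∀ (f : ℕ → ℕ) k h → h ≤ k → sumTo k (λ b → ⟦ b <ᵇ h ⟧ * f b) ≡ sumTo h f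
  sumTo-initial f zero    zero h≤k = refl
  sumTo-initial f (suc k) h h≤k with k <? h
  ... | yes k<h with refl ← ≤-antisym h≤k k<h rewrite <ᵇ-true k<h =
    cong₂ _+_ (+-identityʳ (f k)) (trans (sumTo-cong′ k (λ b b<k → cong (λ x → ⟦ x ⟧ * f b) (trans (<ᵇ-true (m<n⇒m<1+n b<k)) (sym (<ᵇ-true b<k))))) (sumTo-initial f k k ≤-refl))
    where
    sumTo-cong′ : ∀ j {f g : ℕ → ℕ} → (∀ b → b < j → f b ≡ g b) → sumTo j f ≡ sumTo j g
    sumTo-cong′ zero    f≡g = refl
    sumTo-cong′ (suc j) f≡g = cong₂ _+_ (f≡g j ≤-refl) (sumTo-cong′ j (λ b b<j → f≡g b (m<n⇒m<1+n b<j)))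
  ... | no k≮h with k <ᵇ h in eq
  ...   | true  = ⊥-elim (k≮h (<ᵇ-true⁻ k eq))
  ...   | false = sumTo-initial f k h (≮⇒≥ k≮h)

  count-initial : ∀ k h → h ≤ k → count k (_<ᵇ h) ≡ h
  count-initial k h h≤k = trans (sumTo-cong k (λ b → sym (*-identityʳ ⟦ b <ᵇ h ⟧)))
    (trans (sumTo-initial (λ _ → 1) k h h≤k) (ones h))
    where
    ones : ∀ h → sumTo h (λ _ → 1) ≡ h
    ones zero    = refl
    ones (suc h) = cong suc (ones h)

  -- The total degree of a column of monomials over a base of degree `s`, when the exponents of the
  -- varying variable are those satisfying `P`.
  weight : ℕ → ℕ → (ℕ → Bool) → ℕ
  weight s k P = sumTo k (λ b → ⟦ P b ⟧ * (b + s))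

  initial-weight≤ : ∀ s k P → sumTo (count k P) (_+ s) ≤ weight s k P
  initial-weight≤ s zero    P = z≤n
  initial-weight≤ s (suc k) P with P k
  ... | true  = +-mono-≤ (≤-trans (+-monoˡ-≤ s (count≤ k P)) (m≤m+n _ 0)) (initial-weight≤ s k P)
  ... | false = initial-weight≤ s k P

  -- If the top exponent `k` occurs, the lightest arrangement would have `count k P` in its place.
  -- Minimality therefore gives `k ≤ count k P`, so no exponent below `k` is missing.
  minimal-weight⇒initial : ∀ s k P → weight s k P ≤ sumTo (count k P) (_+ s) →
                           ∀ b → suc b < k → P (suc b) ≡ true → P b ≡ true
  minimal-weight⇒initial s (suc k) P le b b<k Pb with P k in eq
  ... | false = minimal-weight⇒initial s k P le b (≤∧≢⇒< (s≤s⁻¹ b<k) λ { refl → contradiction (trans (sym Pb) eq) λ () }) Pb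
  ... | true = count-full k P (+-cancelʳ-≤ s k _ (≤-trans (m≤m+n _ 0)
                 (proj₁ (squeeze (≤-trans (+-monoˡ-≤ s (count≤ k P)) (m≤m+n _ 0)) (initial-weight≤ s k P) le)))) (s≤s⁻¹ b<k)

  -- The one-dimensional case of Macaulay's theorem.
  count-shadow : ∀ t P Q → (∀ b → b < t → P b ≡ true → Q b ≡ true) → (∀ b → P (suc b) ≡ true → Q b ≡ true) →
                 count (suc t) P ≤ count t Q ⊎ t ≤ count t Q
  count-shadow zero    P Q same down = inj₂ z≤n
  count-shadow (suc t) P Q same down with P (suc t) in eq
  ... | false = inj₁ (go (suc t) ≤-refl)
    where
    go : ∀ j → j ≤ suc t → count j P ≤ count j Q
    go zero    _   = z≤n
    go (suc j) j<t = +-mono-≤ (⟦⟧-mono (same j j<t)) (go j (<⇒≤ j<t))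
  ... | true rewrite down t eq with count-shadow t P Q (λ b b<t → same b (m<n⇒m<1+n b<t)) down
  ...   | inj₁ le = inj₁ (s≤s le)
  ...   | inj₂ le = inj₂ (s≤s le)

  -- Exponent vectors and sums over a box.

  deg-updateAt-suc : ∀ {n} (v : Vec ℕ n) i → deg (updateAt v i suc) ≡ suc (deg v)
  deg-updateAt-suc (a ∷ v) zero    = refl
  deg-updateAt-suc (a ∷ v) (suc i) = trans (cong (a +_) (deg-updateAt-suc v i)) (+-suc a (deg v))

  deg-insertAt : ∀ {n} (v : Vec ℕ n) i b → deg (insertAt v i b) ≡ b + deg v
  deg-insertAt v       zero    b = refl
  deg-insertAt (a ∷ v) (suc i) b = trans (cong (a +_) (deg-insertAt v i b)) (lemma a b (deg v))
    where
    lemma : ∀ a b c → a + (b + c) ≡ b + (a + c)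
    lemma = solve-∀

  updateAt-insertAt-same : ∀ {n} (v : Vec ℕ n) i b → updateAt (insertAt v i b) i suc ≡ insertAt v i (suc b)
  updateAt-insertAt-same v       zero    b = refl
  updateAt-insertAt-same (a ∷ v) (suc i) b = cong (a ∷_) (updateAt-insertAt-same v i b)

  updateAt-insertAt-other : ∀ {n} (v : Vec ℕ n) i j b →
                            updateAt (insertAt v i b) (punchIn i j) suc ≡ insertAt (updateAt v j suc) i b
  updateAt-insertAt-other v       zero    j       b = refl
  updateAt-insertAt-other (a ∷ v) (suc i) zero    b = refl
  updateAt-insertAt-other (a ∷ v) (suc i) (suc j) b = cong (a ∷_) (updateAt-insertAt-other v i j b)

  -- Here `φ k` stands for the number of monomials of degree `k` in an order ideal and `c k` for the
  -- number of those of degree below `k`. A large top degree forces large lower degrees by `step`.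
  -- In the sum over all degrees each letter of the word pays for one degree, and the strict
  -- inequality on `φ` absorbs the extra 1 of `rank-upper`.
  ladder : ∀ (φ c : ℕ → ℕ) (e : ℕ) → (∀ k → φ k + c k ≤ c (suc k)) →
    (∀ k t ts → k ≤ e → length ts ≡ k → rank 0 (t ∷ ts) < φ (suc k) → rank 0 ts < φ k) →
    ∀ k t ts → k ≤ e → length ts ≡ k → rank 0 (map pred (t ∷ ts)) < φ (suc k) → rank 0 ts < c (suc k)
  ladder φ c e cum step k t ts k≤e len lt with step k (pred t) (map pred ts) k≤e (trans (length-map pred ts) len) lt
  ladder φ c e cum step zero t [] k≤e len lt | lt′ = <-≤-trans lt′ (≤-trans (m≤m+n _ _) (cum 0))
  ladder φ c e cum step (suc k) t (t′ ∷ ts) k≤e len lt | lt′ = begin-strict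
    rank 0 (t′ ∷ ts)                                ≤⟨ rank-upper t′ ts ⟩
    suc (rank 0 (map pred (t′ ∷ ts)) + rank 0 ts)   ≤⟨ +-monoˡ-≤ (rank 0 ts) lt′ ⟩
    φ (suc k) + rank 0 ts                           <⟨ +-monoʳ-< (φ (suc k)) (ladder φ c e cum step k t′ ts (<⇒≤ k≤e) (suc-injective len) lt′) ⟩
    φ (suc k) + c (suc k)                           ≤⟨ cum (suc k) ⟩
    c (suc (suc k))                                 ∎
    where open ≤-Reasoning

  -- Only monomials in the box [0,K)ⁿ are counted; K always exceeds the degrees in play.
  module Box (K : ℕ) where

    boxSum : ∀ n → (Vec ℕ n → ℕ) → ℕ
    boxSum zero    f = f []
    boxSum (suc n) f = sumTo K (λ a → boxSum n (λ v → f (a ∷ v)))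

    boxSum-mono : ∀ n {f g} → (∀ v → f v ≤ g v) → boxSum n f ≤ boxSum n g
    boxSum-mono zero    f≤g = f≤g []
    boxSum-mono (suc n) f≤g = sumTo-mono K (λ a → boxSum-mono n (λ v → f≤g (a ∷ v)))

    boxSum-cong : ∀ n {f g} → (∀ v → f v ≡ g v) → boxSum n f ≡ boxSum n g
    boxSum-cong zero    f≡g = f≡g []
    boxSum-cong (suc n) f≡g = sumTo-cong K (λ a → boxSum-cong n (λ v → f≡g (a ∷ v)))

    boxSum-+ : ∀ n f g → boxSum n (λ v → f v + g v) ≡ boxSum n f + boxSum n g
    boxSum-+ zero    f g = refl
    boxSum-+ (suc n) f g = trans (sumTo-cong K (λ a → boxSum-+ n _ _)) (sumTo-+ K _ _)

    boxSum-zero : ∀ n → boxSum n (λ _ → 0) ≡ 0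
    boxSum-zero zero    = refl
    boxSum-zero (suc n) = trans (sumTo-cong K (λ _ → boxSum-zero n)) (sumTo-zero K)

    boxSum-squeeze : ∀ n {f g} → (∀ v → f v ≤ g v) → boxSum n g ≤ boxSum n f → ∀ v → deg v < K → g v ≤ f v
    boxSum-squeeze zero    f≤g le []      _   = le
    boxSum-squeeze (suc n) f≤g le (a ∷ v) v<K =
      boxSum-squeeze n (λ w → f≤g (a ∷ w))
        (sumTo-squeeze K (λ a → boxSum-mono n (λ v → f≤g (a ∷ v))) le (≤-<-trans (m≤m+n a (deg v)) v<K))
        v (≤-<-trans (m≤n+m (deg v) a) v<K)

    sumTo-boxSum-swap : ∀ n (f : ℕ → Vec ℕ n → ℕ) →
                        sumTo K (λ a → boxSum n (f a)) ≡ boxSum n (λ v → sumTo K (λ a → f a v))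
    sumTo-boxSum-swap zero    f = refl
    sumTo-boxSum-swap (suc n) f = trans (sumTo-swap K K _) (sumTo-cong K (λ b → sumTo-boxSum-swap n (λ a v → f a (b ∷ v))))

    boxSum-insertAt : ∀ n (i : Fin (suc n)) f → boxSum (suc n) f ≡ boxSum n (λ v → sumTo K (λ b → f (insertAt v i b)))
    boxSum-insertAt n       zero    f = sumTo-boxSum-swap n (λ a v → f (a ∷ v))
    boxSum-insertAt (suc n) (suc i) f = sumTo-cong K (λ a → boxSum-insertAt n i (λ v → f (a ∷ v)))

    card : ∀ {n} → (Vec ℕ n → Bool) → ℕ
    card {n} F = boxSum n (λ v → ⟦ F v ⟧)

    card-mono : ∀ {n} {F G : Vec ℕ n → Bool} → (∀ v → F v ≡ true → G v ≡ true) → card F ≤ card G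
    card-mono {n} F⇒G = boxSum-mono n (λ v → ⟦⟧-mono (F⇒G v))

    totalDeg : ∀ {n} → (Vec ℕ n → Bool) → ℕ
    totalDeg {n} F = boxSum n (λ v → ⟦ F v ⟧ * deg v)

    -- Compression along one variable.

    module Compression {n} (i : Fin (suc n)) where

      height : (Vec ℕ (suc n) → Bool) → Vec ℕ n → ℕ
      height F v = count K (λ b → F (insertAt v i b))

      -- The push-down of extremal set theory: each column in direction `i` becomes an interval of
      -- the same size starting at exponent 0.
      compress : (Vec ℕ (suc n) → Bool) → Vec ℕ (suc n) → Bool
      compress F v = lookup v i <ᵇ height F (removeAt v i)

      compress-insertAt : ∀ F v b → compress F (insertAt v i b) ≡ (b <ᵇ height F v)
      compress-insertAt F v b = cong₂ (λ x y → x <ᵇ height F y) (insertAt-lookup v i b) (removeAt-insertAt v i b)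

      card-compress : ∀ F → card (compress F) ≡ card F
      card-compress F = begin
        card (compress F)                                          ≡⟨ boxSum-insertAt n i (λ v → ⟦ compress F v ⟧) ⟩
        boxSum n (λ v → count K (λ b → compress F (insertAt v i b))) ≡⟨ boxSum-cong n (λ v → trans
                                                                         (sumTo-cong K (λ b → cong ⟦_⟧ (compress-insertAt F v b)))
                                                                         (count-initial K _ (count≤ K _))) ⟩
        boxSum n (height F)                                        ≡⟨ boxSum-insertAt n i (λ v → ⟦ F v ⟧) ⟨
        card F                                                     ∎
        where open ≡-Reasoning

      totalDeg-insertAt : ∀ F → totalDeg F ≡ boxSum n (λ v → weight (deg v) K (λ b → F (insertAt v i b)))
      totalDeg-insertAt F = trans (boxSum-insertAt n i (λ v → ⟦ F v ⟧ * deg v))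
        (boxSum-cong n (λ v → sumTo-cong K (λ b → cong (⟦ F (insertAt v i b) ⟧ *_) (deg-insertAt v i b))))

      totalDeg-compress : ∀ F → totalDeg (compress F) ≡ boxSum n (λ v → sumTo (height F v) (_+ deg v))
      totalDeg-compress F = trans (totalDeg-insertAt (compress F)) (boxSum-cong n (λ v → trans
        (sumTo-cong K (λ b → cong (λ x → ⟦ x ⟧ * (b + deg v)) (compress-insertAt F v b)))
        (sumTo-initial (_+ deg v) K _ (count≤ K _))))

      -- The total degree is the sum of the column weights, and compression minimises each of them
      -- separately. If the sum does not drop, every column that meets the box already has minimal
      -- weight and is an interval from 0.
      minimal⇒closed : ∀ F → (∀ v → F v ≡ true → deg v < K) → totalDeg F ≤ totalDeg (compress F) →
                       ∀ v → F (updateAt v i suc) ≡ true → F v ≡ true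
      minimal⇒closed F F<K le v Fv′ = subst (λ x → F x ≡ true) v≡ (minimal-weight⇒initial (deg m) K _
          (boxSum-squeeze n (λ w → initial-weight≤ (deg w) K _)
            (subst₂ _≤_ (totalDeg-insertAt F) (totalDeg-compress F) le) m (≤-<-trans (m≤n+m _ _) deg<K))
          b (≤-<-trans (m≤m+n _ _) deg<K) Fins)
        where
        m = removeAt v i
        b = lookup v i
        v≡ : insertAt m i b ≡ v
        v≡ = insertAt-removeAt v i
        Fins : F (insertAt m i (suc b)) ≡ true
        Fins = subst (λ x → F x ≡ true) (trans (cong (λ x → updateAt x i suc) (sym v≡)) (updateAt-insertAt-same m i b)) Fv′
        deg<K : suc b + deg m < K
        deg<K = subst (_< K) (deg-insertAt m i (suc b)) (F<K _ Fins)

    -- The dehomogenised form of "B contains the shadow of F": the exponent of the first variable,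
    -- which is determined by the degree, has been dropped.
    record Shadow {n} (d : ℕ) (F B : Vec ℕ n → Bool) : Set where
      field
        deg≤ : ∀ v → F v ≡ true → deg v ≤ suc d
        same : ∀ v → F v ≡ true → deg v ≤ d → B v ≡ true
        down : ∀ v i → F (updateAt v i suc) ≡ true → B v ≡ true
    open Shadow

    module _ {n d} {F B : Vec ℕ (suc n) → Bool} (d<K : suc d < K) (sh : Shadow d F B) (i : Fin (suc n)) where
      open Compression i

      private
        column-deg : ∀ v b → F (insertAt v i b) ≡ true → b + deg v ≤ suc d
        column-deg v b Fb = subst (_≤ suc d) (deg-insertAt v i b) (deg≤ sh _ Fb)

        height-deg : ∀ v b → b < height F v → b + deg v ≤ suc d
        height-deg v b b<h with deg v ≤? suc d
        ... | yes v≤ = m≤o∸n⇒m+n≤o b v≤ (s≤s⁻¹ (<-≤-trans b<h (≤-trans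
                (count-truncate K (suc (suc d ∸ deg v)) _ (λ c Fc → s≤s (m+n≤o⇒m≤o∸n c (column-deg v c Fc))))
                (count≤ (suc (suc d ∸ deg v)) _))))
        ... | no v≰ = ⊥-elim (n≮0 (<-≤-trans b<h
                (count-truncate K 0 _ (λ c Fc → ⊥-elim (v≰ (≤-trans (m≤n+m _ c) (column-deg v c Fc)))))))

        height-same : ∀ v b → b < height F v → b + deg v ≤ d → b < height B v
        -- Over `v` the exponents occurring in `F` are at most `t`, the number `suc d ∸ deg v`.
        -- Either the column of `B` is at least as high as that of `F`, or it contains every
        -- exponent below `t`, and `b` is one of these.
        height-same v b b<h b≤d with count-shadow t (λ c → F (insertAt v i c)) (λ c → B (insertAt v i c))
            (λ c c<t Fc → same sh _ Fc (subst (_≤ d) (sym (deg-insertAt v i c)) (s≤s⁻¹ (m≤o∸n⇒m+n≤o (suc c) v≤ c<t))))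
            (λ c Fc → down sh _ i (trans (cong F (updateAt-insertAt-same v i c)) Fc))
          where
          v≤ : deg v ≤ suc d
          v≤ = m≤n⇒m≤1+n (≤-trans (m≤n+m _ b) b≤d)
          t = suc d ∸ deg v
        ... | inj₁ le = <-≤-trans b<h (≤-trans (count-truncate K (suc (suc d ∸ deg v)) _
                          (λ c Fc → s≤s (m+n≤o⇒m≤o∸n c (column-deg v c Fc))))
                          (≤-trans le (sumTo-extend _ (≤-trans (m∸n≤m (suc d) (deg v)) (<⇒≤ d<K)))))
        ... | inj₂ le = <-≤-trans (m+n≤o⇒m≤o∸n (suc b) (s≤s b≤d))
                          (≤-trans le (sumTo-extend _ (≤-trans (m∸n≤m (suc d) (deg v)) (<⇒≤ d<K))))

        via-column : ∀ {P : Vec ℕ (suc n) → Set} → (∀ v b → P (insertAt v i b)) → ∀ v → P v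
        via-column {P} p v = subst P (insertAt-removeAt v i) (p _ _)

      -- Inside one column this is the one-dimensional case, `height-same`. Division by another
      -- variable sends the column of `F` over a multiple of `v` into the column of `B` over `v`, so
      -- comparing heights is enough.
      compress-shadow : Shadow d (compress F) (compress B)
      deg≤ compress-shadow = via-column λ v b cF → subst (_≤ suc d) (sym (deg-insertAt v i b))
        (height-deg v b (<ᵇ-true⁻ b (trans (sym (compress-insertAt F v b)) cF)))
      same compress-shadow = via-column λ v b cF le → trans (compress-insertAt B v b) (<ᵇ-true
        (height-same v b (<ᵇ-true⁻ b (trans (sym (compress-insertAt F v b)) cF)) (subst (_≤ d) (deg-insertAt v i b) le)))
      down compress-shadow = via-column λ v b j → go v b j (i Fin.≟ j)
        where
        go : ∀ v b j → Dec (i ≡ j) → compress F (updateAt (insertAt v i b) j suc) ≡ true → compress B (insertAt v i b) ≡ true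
        go v b j (yes refl) cF = trans (compress-insertAt B v b) (<ᵇ-true
          (height-same v b (<⇒≤ sb<h) (s≤s⁻¹ (height-deg v (suc b) sb<h))))
          where
          sb<h : suc b < height F v
          sb<h = <ᵇ-true⁻ (suc b) (trans (sym (compress-insertAt F v (suc b)))
                   (trans (cong (compress F) (sym (updateAt-insertAt-same v i b))) cF))
        go v b j (no i≢j) cF = trans (compress-insertAt B v b) (<ᵇ-true (<-≤-trans b<h
            (sumTo-mono K (λ c → ⟦⟧-mono (λ Fc → down sh _ (punchIn i k) (trans (cong F (updateAt-insertAt-other v i k c)) Fc))))))
          where
          k = Fin.punchOut i≢j
          b<h : b < height F (updateAt v k suc)
          b<h = <ᵇ-true⁻ b (trans (sym (compress-insertAt F _ b)) (trans (cong (compress F)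
                  (trans (sym (updateAt-insertAt-other v i k b)) (cong (λ x → updateAt (insertAt v i b) x suc) (Fin.punchIn-punchOut i≢j)))) cF))

    -- Macaulay's theorem by induction on the number of variables.

    AffineMacaulay HomogeneousMacaulay : ℕ → Set
    AffineMacaulay n = ∀ d (F B : Vec ℕ n → Bool) → suc d < K → Shadow d F B →
      ∀ t ts → length ts ≡ d → rank 0 (t ∷ ts) < card F → rank 0 ts < card B
    HomogeneousMacaulay n = ∀ d (F B : Vec ℕ n → Bool) → suc d < K →
      (∀ v → F v ≡ true → deg v ≡ suc d) → (∀ v i → F (updateAt v i suc) ≡ true → B v ≡ true) →
      ∀ t ts → length ts ≡ d → rank 0 (t ∷ ts) < card F → rank 0 ts < card B

    -- If F has few elements of degree ≤ d, then it has many of degree suc d, hence (by the theorem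
    -- for homogeneous families) many in every smaller degree.
    order-ideal-macaulay : ∀ {n} → HomogeneousMacaulay n → ∀ d (F B : Vec ℕ n → Bool) → suc d < K → Shadow d F B →
      (∀ v i → F (updateAt v i suc) ≡ true → F v ≡ true) →
      ∀ t ts → length ts ≡ d → rank 0 (t ∷ ts) < card F → rank 0 ts < card B
    order-ideal-macaulay {n} hom d F B d<K sh closed t ts len lt with rank 0 ts <? card (λ v → F v ∧ (deg v <ᵇ suc d))
    ... | yes lt′ = <-≤-trans lt′ (card-mono λ v below →
                      same sh v (∧-true⁻ˡ below) (s≤s⁻¹ (<ᵇ-true⁻ (deg v) (∧-true⁻ʳ {F v} below))))
    ... | no  ge  = ⊥-elim (ge (ladder φ c d (λ k → ≤-reflexive (cum k)) step d t ts ≤-refl len top))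
      where
      slice below : ℕ → Vec ℕ n → Bool
      slice k v = F v ∧ (deg v ≡ᵇ k)
      below k v = F v ∧ (deg v <ᵇ k)
      φ c : ℕ → ℕ
      φ k = card (slice k)
      c k = card (below k)
      slice-deg : ∀ k v → slice k v ≡ true → deg v ≡ k
      slice-deg k v eq = ≡ᵇ⇒≡ (deg v) k (Equivalence.from T-≡ (∧-true⁻ʳ {F v} eq))
      slice-intro : ∀ v → F v ≡ true → slice (deg v) v ≡ true
      slice-intro v Fv = ∧-true Fv (Equivalence.to T-≡ (≡⇒≡ᵇ (deg v) (deg v) refl))
      split : ∀ m k → ⟦ m ≡ᵇ k ⟧ + ⟦ m <ᵇ k ⟧ ≡ ⟦ m <ᵇ suc k ⟧
      split zero    zero    = refl
      split zero    (suc k) = refl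
      split (suc m) zero    = refl
      split (suc m) (suc k) = split m k
      cum : ∀ k → φ k + c k ≡ c (suc k)
      cum k = trans (sym (boxSum-+ n _ _)) (boxSum-cong n pointwise)
        where
        pointwise : ∀ v → ⟦ slice k v ⟧ + ⟦ below k v ⟧ ≡ ⟦ below (suc k) v ⟧
        pointwise v with F v
        ... | true  = split (deg v) k
        ... | false = refl
      step : ∀ k t ts → k ≤ d → length ts ≡ k → rank 0 (t ∷ ts) < φ (suc k) → rank 0 ts < φ k
      step k t ts k≤d = hom k (slice (suc k)) (slice k) (≤-<-trans (s≤s k≤d) d<K) (slice-deg (suc k))
        (λ v i eq → subst (λ j → slice j v ≡ true) (suc-injective (trans (sym (deg-updateAt-suc v i)) (slice-deg (suc k) _ eq)))
          (slice-intro v (closed v i (∧-true⁻ˡ eq)))) t ts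
      top : rank 0 (map pred (t ∷ ts)) < φ (suc d)
      top = +-cancelʳ-< (rank 0 ts) _ _ (begin-strict
        rank 0 (map pred (t ∷ ts)) + rank 0 ts ≤⟨ rank-lower t ts ⟩
        rank 0 (t ∷ ts)                        <⟨ lt ⟩
        card F                                 ≤⟨ card-mono (λ v Fv → ∧-true Fv (<ᵇ-true (s≤s (deg≤ sh v Fv)))) ⟩
        c (suc (suc d))                        ≡⟨ cum (suc d) ⟨
        φ (suc d) + c (suc d)                  ≤⟨ +-monoʳ-≤ (φ (suc d)) (≮⇒≥ ge) ⟩
        φ (suc d) + rank 0 ts                  ∎)
        where open ≤-Reasoning

    -- Compression towards small exponents preserves cardinalities and shadows and lowers the total
    -- degree, unless F is already an order ideal.
    homogeneous⇒affine : ∀ {n} → HomogeneousMacaulay n → AffineMacaulay n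
    homogeneous⇒affine {zero} hom d F B d<K sh = order-ideal-macaulay hom d F B d<K sh (λ v ())
    homogeneous⇒affine {suc n} hom d F B d<K sh t ts len = go F B sh (<-wellFounded (totalDeg F))
      where
      go : ∀ F B → Shadow d F B → Acc _<_ (totalDeg F) → rank 0 (t ∷ ts) < card F → rank 0 ts < card B
      go F B sh (acc rec) lt with Fin.any? (λ i → totalDeg (Compression.compress i F) <? totalDeg F)
      ... | yes (i , smaller) = subst (rank 0 ts <_) (card-compress B)
              (go (compress F) (compress B) (compress-shadow d<K sh i) (rec smaller)
                (subst (rank 0 (t ∷ ts) <_) (sym (card-compress F)) lt))
        where open Compression i
      ... | no minimal = order-ideal-macaulay hom d F B d<K sh
              (λ v i → Compression.minimal⇒closed i F (λ v Fv → ≤-<-trans (deg≤ sh v Fv) d<K) (≮⇒≥ λ lt → minimal (i , lt)) v)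
              t ts len lt

    -- In a homogeneous family the first exponent is `suc d ∸ deg v`, so dropping it loses nothing.
    -- Division by the first variable turns into `same`, division by any other variable into `down`.
    affine⇒homogeneous : ∀ {n} → AffineMacaulay n → HomogeneousMacaulay (suc n)
    affine⇒homogeneous {n} affine d F B d<K degF down′ t ts len lt = <-≤-trans
        (affine d (λ v → F (suc d ∸ deg v ∷ v)) (λ v → B (d ∸ deg v ∷ v)) d<K sh t ts len (<-≤-trans lt F≤)) ≤B
      where
      sh : Shadow d (λ v → F (suc d ∸ deg v ∷ v)) (λ v → B (d ∸ deg v ∷ v))
      deg≤ sh v Fv = subst (deg v ≤_) (degF _ Fv) (m≤n+m (deg v) (suc d ∸ deg v))
      same sh v Fv v≤d = down′ _ zero (subst (λ a → F (a ∷ v) ≡ true) (+-∸-assoc 1 v≤d) Fv)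
      down sh v i Fv = down′ _ (suc i) (subst (λ a → F (suc d ∸ a ∷ updateAt v i suc) ≡ true) (deg-updateAt-suc v i) Fv)
      F≤ : card F ≤ boxSum n (λ v → ⟦ F (suc d ∸ deg v ∷ v) ⟧)
      F≤ = ≤-trans (≤-reflexive (sumTo-boxSum-swap n _)) (boxSum-mono n (λ v →
        count-at-most-one K (λ a → F (a ∷ v)) (suc d ∸ deg v)
          (λ a Fa → trans (sym (m+n∸n≡m a (deg v))) (cong (_∸ deg v) (degF _ Fa)))))
      ≤B : boxSum n (λ v → ⟦ B (d ∸ deg v ∷ v) ⟧) ≤ card B
      ≤B = ≤-trans (boxSum-mono n (λ v → term≤sumTo K (λ a → ⟦ B (a ∷ v) ⟧) (≤-<-trans (m∸n≤m d (deg v)) (<⇒≤ d<K))))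
        (≤-reflexive (sym (sumTo-boxSum-swap n _)))

    homogeneous-macaulay : ∀ n → HomogeneousMacaulay n
    homogeneous-macaulay zero d F B _ degF _ t ts _ lt with F [] in eq
    ... | true with () ← degF [] eq
    homogeneous-macaulay (suc n) = affine⇒homogeneous (homogeneous⇒affine (homogeneous-macaulay n))

    -- This is the word form at `t = 0`, because `rank 0 (0 ∷ w)` is `rank 1 w`, the Macaulay bound.
    -- Letting `c` be any upper bound for `card B` builds in the monotonicity of `macaulayBound`.
    macaulay : ∀ {n} d c (F B : Vec ℕ n → Bool) → suc (suc d) < K →
      (∀ v → F v ≡ true → deg v ≡ suc (suc d)) → (∀ v i → F (updateAt v i suc) ≡ true → B v ≡ true) →
      card B ≤ c → card F ≤ macaulayBound (suc d) c
    -- The variables of the expansion are unrelated to the `n` variables of `F`; with `suc c` of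
    -- them there are more than `c` monomials of degree `suc d`, so position `c` exists.
    macaulay {n} d c F B d<K degF down B≤c with expand c (suc d) c (m<[m+1+d]C[1+d] c d)
    ... | b , ε with Expansion⇒word ε
    ...   | w , len , refl , refl = ≮⇒≥ λ lt → <⇒≱
      (homogeneous-macaulay n (suc d) F B d<K degF down 0 w len (subst (_< card F) (macaulayBound≡bound ε) lt)) B≤c

-- Integer linear algebra and the sl₂-operators.

module PureIdeals where

  open Macaulay
  open import Data.Nat as ℕ using (ℕ; zero; suc; z≤n; s≤s)
  import Data.Nat.Properties as ℕ
  open import Data.Integer as ℤ using (ℤ; +_; 0ℤ; 1ℤ; _+_; _*_; _-_; -_)
  import Data.Integer.Properties as ℤ
  open import Data.Integer.Tactic.RingSolver using (solve-∀)
  open import Algebra.Properties.Semiring.Sum ℤ.+-*-semiring using (sum; sum-cong-≗; sum-remove; ∑-distrib-+; *-distribˡ-sum; sum-replicate-zero)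
  open import Data.Bool using (Bool; true; false; if_then_else_; _∨_)
  open import Data.Fin using (Fin; zero; suc; punchIn)
  import Data.Fin.Properties as Fin
  open import Data.Vec using (Vec; []; _∷_; lookup; updateAt)
  import Data.Vec.Properties as Vec
  import Data.Vec.Functional as Vector
  import Data.Vec.Functional.Properties as Vector
  open import Data.List as List using (List; []; _∷_; length; filter; allFin)
  open import Data.List.Membership.Propositional using (_∈_)
  open import Data.List.Membership.Propositional.Properties using (∈-filter⁺; ∈-filter⁻; ∈-lookup; ∈-allFin)
  open import Data.List.Membership.DecPropositional using () renaming (_∈?_ to mem?)
  open import Data.List.Relation.Unary.Any as Any using (here; there; index)
  open import Data.List.Relation.Unary.Any.Properties using (lookup-index)
  open import Data.List.Relation.Unary.All as All using (All; []; _∷_)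
  open import Data.List.Relation.Unary.AllPairs using ([]; _∷_)
  open import Data.List.Relation.Unary.Unique.Propositional using (Unique)
  import Data.List.Relation.Unary.Unique.Propositional.Properties as Unique
  open import Data.Product using (Σ; _×_; _,_; proj₁; proj₂; ∃-syntax)
  open import Data.Sum using (_⊎_; inj₁; inj₂)
  open import Data.Empty using (⊥-elim)
  open import Function using (_∘_)
  open import Relation.Nullary using (¬_; Dec; yes; no; ¬?; does)
  open import Relation.Nullary.Decidable using (decidable-stable; ¬¬-excluded-middle; dec-true; dec-false; map′)
  open import Relation.Unary using (Pred; Decidable)
  open import Relation.Binary using (tri<; tri≈; tri>)
  open import Relation.Binary.PropositionalEquality

  -- Fraction-free Gaussian elimination.
  linear-relation : ∀ m {k} (φ : Fin k → Fin m → ℤ) → m ℕ.< k →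
    Σ (Fin k → ℤ) λ c → (∃[ i ] c i ≢ 0ℤ) × (∀ j → sum (λ i → c i * φ i j) ≡ 0ℤ)
  linear-relation zero    {suc k} φ m<k = (λ _ → 1ℤ) , (zero , λ ()) , λ ()
  linear-relation (suc m) {suc k} φ m<k with Fin.any? (λ i → ¬? (φ i zero ℤ.≟ 0ℤ))
  ... | no vanish with linear-relation m (λ i j → φ i (suc j)) (ℕ.<-trans (ℕ.n<1+n m) m<k)
  ...   | c , nonzero , rel = c , nonzero , λ where
          zero    → trans (sum-cong-≗ (λ i → trans (cong (c i *_) (decidable-stable (φ i zero ℤ.≟ 0ℤ) λ nz → vanish (i , nz))) (ℤ.*-zeroʳ (c i))))
                          (sum-replicate-zero (suc k))
          (suc j) → rel j
  linear-relation (suc m) {suc k} φ m<k | yes (p , π≢0)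
    with linear-relation m (λ i j → φ p zero * φ (punchIn p i) (suc j) - φ (punchIn p i) zero * φ p (suc j)) (ℕ.s≤s⁻¹ m<k)
  ... | c , (i₀ , ci₀≢0) , rel = c⁺ , (punchIn p i₀ , nonzero) , vanishes
    where
    π = φ p zero
    S : Fin (suc m) → ℤ
    S j = sum (λ i → c i * φ (punchIn p i) j)
    -- Scaling the relation for the reduced rows by the pivot `π` avoids division; the coefficient
    -- of row `p` is then dictated by column `zero`.
    c⁺ : Fin (suc k) → ℤ
    c⁺ = Vector.insertAt (λ i → π * c i) p (- S zero)
    nonzero : c⁺ (punchIn p i₀) ≢ 0ℤ
    nonzero eq with ℤ.i*j≡0⇒i≡0∨j≡0 π (trans (sym (Vector.insertAt-punchIn (λ i → π * c i) p (- S zero) i₀)) eq)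
    ... | inj₁ π≡0 = π≢0 π≡0
    ... | inj₂ c≡0 = ci₀≢0 c≡0
    sum-c⁺ : ∀ j → sum (λ i → c⁺ i * φ i j) ≡ - S zero * φ p j + π * S j
    sum-c⁺ j = trans (sum-remove {i = p} (λ i → c⁺ i * φ i j)) (cong₂ _+_
      (cong (_* φ p j) (Vector.insertAt-lookup (λ i → π * c i) p (- S zero)))
      (trans (sum-cong-≗ (λ i → trans (cong (_* φ (punchIn p i) j) (Vector.insertAt-punchIn (λ i → π * c i) p (- S zero) i)) (ℤ.*-assoc π (c i) (φ (punchIn p i) j))))
        (sym (*-distribˡ-sum π (λ i → c i * φ (punchIn p i) j)))))
    cancel : ∀ s π → - s * π + π * s ≡ 0ℤ
    cancel = solve-∀
    vanishes : ∀ j → sum (λ i → c⁺ i * φ i j) ≡ 0ℤ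
    vanishes zero    = trans (sum-c⁺ zero) (cancel (S zero) π)
    vanishes (suc j) = begin
      sum (λ i → c⁺ i * φ i (suc j))                                ≡⟨ sum-c⁺ (suc j) ⟩
      - S zero * φ p (suc j) + π * S (suc j)                        ≡⟨ rearrange (S zero) (φ p (suc j)) (π * S (suc j)) ⟩
      π * S (suc j) + - φ p (suc j) * S zero                        ≡⟨ cong₂ _+_ (*-distribˡ-sum π (λ i → c i * φ (punchIn p i) (suc j))) (*-distribˡ-sum (- φ p (suc j)) (λ i → c i * φ (punchIn p i) zero)) ⟩
      sum (λ i → π * (c i * φ (punchIn p i) (suc j))) + sum (λ i → - φ p (suc j) * (c i * φ (punchIn p i) zero))
                                                                    ≡⟨ ∑-distrib-+ (λ i → π * (c i * φ (punchIn p i) (suc j))) (λ i → - φ p (suc j) * (c i * φ (punchIn p i) zero)) ⟨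
      sum (λ i → π * (c i * φ (punchIn p i) (suc j)) + - φ p (suc j) * (c i * φ (punchIn p i) zero))
                                                                    ≡⟨ sum-cong-≗ (λ i → collect π (c i) (φ (punchIn p i) (suc j)) (φ p (suc j)) (φ (punchIn p i) zero)) ⟩
      sum (λ i → c i * (π * φ (punchIn p i) (suc j) - φ (punchIn p i) zero * φ p (suc j)))
                                                                    ≡⟨ rel j ⟩
      0ℤ ∎
      where
      open ≡-Reasoning
      rearrange : ∀ s f t → - s * f + t ≡ t + - f * s
      rearrange = solve-∀
      collect : ∀ π c x f y → π * (c * x) + - f * (c * y) ≡ c * (π * x - y * f)
      collect = solve-∀

  -- A function Vec ℕ n → ℤ is viewed as a (formal) linear combination of monomials;
  -- U is multiplication by the sum of all variables.
  U : ∀ {n} → (Vec ℕ n → ℤ) → Vec ℕ n → ℤ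
  U f []          = 0ℤ
  U f (zero ∷ v)  = U (λ w → f (zero ∷ w)) v
  U f (suc k ∷ v) = f (k ∷ v) + U (λ w → f (suc k ∷ w)) v

  -- The lowering operator of the sl₂-action on ⊗ᵢ k[xᵢ]/(xᵢ^{aᵢ+1}).
  D : ∀ {n} → Vec ℕ n → (Vec ℕ n → ℤ) → Vec ℕ n → ℤ
  D []      f []      = 0ℤ
  D (α ∷ a) f (k ∷ v) = + suc k * (+ α - + k) * f (suc k ∷ v) + D a (λ w → f (k ∷ w)) v

  U-cong : ∀ {n} (f g : Vec ℕ n → ℤ) v → (∀ w i → updateAt w i suc ≡ v → f w ≡ g w) → U f v ≡ U g v
  U-cong f g []          eq = refl
  U-cong f g (zero ∷ v)  eq = U-cong (λ w → f (zero ∷ w)) (λ w → g (zero ∷ w)) v (λ w i u → eq (zero ∷ w) (suc i) (cong (zero ∷_) u))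
  U-cong f g (suc k ∷ v) eq = cong₂ _+_ (eq (k ∷ v) zero refl)
    (U-cong (λ w → f (suc k ∷ w)) (λ w → g (suc k ∷ w)) v (λ w i u → eq (suc k ∷ w) (suc i) (cong (suc k ∷_) u)))

  -- The factor `α - k` is zero at the top exponent, so at a divisor of `a` the operator reads
  -- values at divisors of `a` only: it descends to the quotient algebra although `f` is defined on
  -- all monomials.
  D-cong : ∀ {n} a (f g : Vec ℕ n → ℤ) v → v ∣ₘ a → (∀ i → updateAt v i suc ∣ₘ a → f (updateAt v i suc) ≡ g (updateAt v i suc)) →
           D a f v ≡ D a g v
  D-cong []      f g []      v≤a eq = refl
  D-cong (α ∷ a) f g (k ∷ v) v≤a eq = cong₂ _+_ head
    (D-cong a (λ w → f (k ∷ w)) (λ w → g (k ∷ w)) v (λ i → v≤a (suc i)) (λ i u → eq (suc i) (λ { zero → v≤a zero ; (suc j) → u j })))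
    where
    head : + suc k * (+ α - + k) * f (suc k ∷ v) ≡ + suc k * (+ α - + k) * g (suc k ∷ v)
    head with k ℕ.≟ α
    ... | yes refl = trans (cancel (+ suc k) (+ k) (f (suc k ∷ v))) (sym (cancel (+ suc k) (+ k) (g (suc k ∷ v))))
      where
      cancel : ∀ s k x → s * (k - k) * x ≡ 0ℤ
      cancel = solve-∀
    ... | no k≢α = cong (+ suc k * (+ α - + k) *_) (eq zero (λ { zero → ℕ.≤∧≢⇒< (v≤a zero) k≢α ; (suc j) → v≤a (suc j) }))

  U-linear : ∀ {n} c (f g : Vec ℕ n → ℤ) v → U (λ w → c * f w + g w) v ≡ c * U f v + U g v
  U-linear c f g []          = sym (trans (ℤ.+-identityʳ (c * 0ℤ)) (ℤ.*-zeroʳ c))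
  U-linear c f g (zero ∷ v)  = U-linear c (λ w → f (zero ∷ w)) (λ w → g (zero ∷ w)) v
  U-linear c f g (suc k ∷ v) = trans (cong (_+_ (c * f (k ∷ v) + g (k ∷ v))) (U-linear c (λ w → f (suc k ∷ w)) (λ w → g (suc k ∷ w)) v))
    (lemma c (f (k ∷ v)) (g (k ∷ v)) (U (λ w → f (suc k ∷ w)) v) (U (λ w → g (suc k ∷ w)) v))
    where
    lemma : ∀ c x y u w → c * x + y + (c * u + w) ≡ c * (x + u) + (y + w)
    lemma = solve-∀

  U-zero : ∀ {n} (v : Vec ℕ n) → U (λ _ → 0ℤ) v ≡ 0ℤ
  U-zero []          = refl
  U-zero (zero ∷ v)  = U-zero v
  U-zero (suc k ∷ v) = trans (ℤ.+-identityˡ _) (U-zero v)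

  U-sum : ∀ {n k} (c : Fin k → ℤ) (q : Fin k → Vec ℕ n → ℤ) v → U (λ w → sum (λ i → c i * q i w)) v ≡ sum (λ i → c i * U (q i) v)
  U-sum {k = zero}  c q v = U-zero v
  U-sum {k = suc k} c q v = trans (U-linear (c zero) (q zero) (λ w → sum (λ i → c (suc i) * q (suc i) w)) v)
    (cong (_+_ (c zero * U (q zero) v)) (U-sum (λ i → c (suc i)) (λ i → q (suc i)) v))

  D-linear : ∀ {n} a c (f g : Vec ℕ n → ℤ) v → D a (λ w → c * f w + g w) v ≡ c * D a f v + D a g v
  D-linear []      c f g []      = sym (trans (ℤ.+-identityʳ (c * 0ℤ)) (ℤ.*-zeroʳ c))
  D-linear (α ∷ a) c f g (k ∷ v) = trans
    (cong (_+_ (+ suc k * (+ α - + k) * (c * f (suc k ∷ v) + g (suc k ∷ v)))) (D-linear a c (λ w → f (k ∷ w)) (λ w → g (k ∷ w)) v))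
    (lemma c (+ suc k * (+ α - + k)) (f (suc k ∷ v)) (g (suc k ∷ v)) (D a (λ w → f (k ∷ w)) v) (D a (λ w → g (k ∷ w)) v))
    where
    lemma : ∀ c s x y u w → s * (c * x + y) + (c * u + w) ≡ c * (s * x + u) + (s * y + w)
    lemma = solve-∀

  D-zero : ∀ {n} a (v : Vec ℕ n) → D a (λ _ → 0ℤ) v ≡ 0ℤ
  D-zero []      []      = refl
  D-zero (α ∷ a) (k ∷ v) = cong₂ _+_ (ℤ.*-zeroʳ (+ suc k * (+ α - + k))) (D-zero a v)

  D-scale : ∀ {n} a c (f : Vec ℕ n → ℤ) v → D a (λ w → c * f w) v ≡ c * D a f v
  D-scale []      c f []      = sym (ℤ.*-zeroʳ c)
  D-scale (α ∷ a) c f (k ∷ v) = trans (cong (_+_ (+ suc k * (+ α - + k) * (c * f (suc k ∷ v)))) (D-scale a c (λ w → f (k ∷ w)) v))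
    (lemma c (+ suc k * (+ α - + k)) (f (suc k ∷ v)) (D a (λ w → f (k ∷ w)) v))
    where
    lemma : ∀ c s x u → s * (c * x) + c * u ≡ c * (s * x + u)
    lemma = solve-∀

  -- Operators in different variables commute. In one variable at exponent k the difference is
  -- (k+1)(α-k) - k(α-k+1) = α - 2k, and these numbers add up over the variables.
  DU-UD : ∀ {n} a (f : Vec ℕ n → ℤ) v → D a (U f) v ≡ U (D a f) v + (+ deg a - (+ deg v + + deg v)) * f v
  DU-UD []      f []         = sym (ℤ.*-zeroˡ (f []))
  DU-UD (α ∷ a) f (zero ∷ v) = begin
    + 1 * (+ α - + 0) * (f (0 ∷ v) + Uf₁) + D a (U f₀) v
      ≡⟨ cong (_+_ (+ 1 * (+ α - + 0) * (f (0 ∷ v) + Uf₁))) (DU-UD a f₀ v) ⟩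
    + 1 * (+ α - + 0) * (f (0 ∷ v) + Uf₁) + (UDf₀ + (+ deg a - (+ deg v + + deg v)) * f (0 ∷ v))
      ≡⟨ lemma (+ α) (f (0 ∷ v)) Uf₁ UDf₀ (+ deg a) (+ deg v) ⟩
    (+ 1 * (+ α - + 0) * Uf₁ + UDf₀) + ((+ α + + deg a) - (+ deg v + + deg v)) * f (0 ∷ v)
      ≡⟨ cong₂ (λ x y → x + (y - (+ deg v + + deg v)) * f (0 ∷ v)) (U-linear (+ 1 * (+ α - + 0)) (λ w → f (1 ∷ w)) (D a f₀) v) (ℤ.pos-+ α (deg a)) ⟨
    U (λ w → + 1 * (+ α - + 0) * f (1 ∷ w) + D a f₀ w) v + (+ (α ℕ.+ deg a) - (+ deg v + + deg v)) * f (0 ∷ v) ∎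
    where
    open ≡-Reasoning
    f₀ = λ w → f (0 ∷ w)
    Uf₁ = U (λ w → f (1 ∷ w)) v
    UDf₀ = U (D a f₀) v
    lemma : ∀ α x u w s d → + 1 * (α - + 0) * (x + u) + (w + (s - (d + d)) * x) ≡ (+ 1 * (α - + 0) * u + w) + ((α + s) - (d + d)) * x
    lemma = solve-∀
  DU-UD (α ∷ a) f (suc k ∷ v) = begin
    κ * (f (suc k ∷ v) + Uf₂) + D a (λ w → f (k ∷ w) + U f₁ w) v
      ≡⟨ cong (_+_ (κ * (f (suc k ∷ v) + Uf₂))) (trans (D-cong′ a (λ w → f (k ∷ w) + U f₁ w) (λ w → + 1 * f (k ∷ w) + U f₁ w) v (λ w → cong (_+ U f₁ w) (sym (ℤ.*-identityˡ (f (k ∷ w)))))) (D-linear a (+ 1) (λ w → f (k ∷ w)) (U f₁) v)) ⟩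
    κ * (f (suc k ∷ v) + Uf₂) + (+ 1 * Df₀ + D a (U f₁) v)
      ≡⟨ cong (λ x → κ * (f (suc k ∷ v) + Uf₂) + (+ 1 * Df₀ + x)) (DU-UD a f₁ v) ⟩
    κ * (f (suc k ∷ v) + Uf₂) + (+ 1 * Df₀ + (UDf₁ + (+ deg a - (+ deg v + + deg v)) * f (suc k ∷ v)))
      ≡⟨ lemma (+ k) (+ α) (f (suc k ∷ v)) Uf₂ Df₀ UDf₁ (+ deg a) (+ deg v) ⟩
    (+ suc k * (+ α - + k) * f (suc k ∷ v) + Df₀ + (κ * Uf₂ + UDf₁)) + ((+ α + + deg a) - (+ suc k + + deg v + (+ suc k + + deg v))) * f (suc k ∷ v)
      ≡⟨ cong₂ (λ x y → (+ suc k * (+ α - + k) * f (suc k ∷ v) + Df₀ + x) + y * f (suc k ∷ v))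
           (U-linear κ (λ w → f (suc (suc k) ∷ w)) (D a f₁) v)
           (cong₂ (λ x y → x - (y + y)) (ℤ.pos-+ α (deg a)) (ℤ.pos-+ (suc k) (deg v))) ⟨
    _ ∎
    where
    open ≡-Reasoning
    κ = + suc (suc k) * (+ α - + suc k)
    f₁ = λ w → f (suc k ∷ w)
    Uf₂ = U (λ w → f (suc (suc k) ∷ w)) v
    Df₀ = D a (λ w → f (k ∷ w)) v
    UDf₁ = U (D a f₁) v
    D-cong′ : ∀ {n} a (f g : Vec ℕ n → ℤ) v → (∀ w → f w ≡ g w) → D a f v ≡ D a g v
    D-cong′ []      f g []      eq = refl
    D-cong′ (α ∷ a) f g (k ∷ v) eq = cong₂ _+_ (cong (+ suc k * (+ α - + k) *_) (eq (suc k ∷ v))) (D-cong′ a (λ w → f (k ∷ w)) (λ w → g (k ∷ w)) v (λ w → eq (k ∷ w)))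
    lemma : ∀ k α x u d w s e →
      (+ 2 + k) * (α - (+ 1 + k)) * (x + u) + (+ 1 * d + (w + (s - (e + e)) * x)) ≡
      ((+ 1 + k) * (α - k) * x + d + ((+ 2 + k) * (α - (+ 1 + k)) * u + w)) + ((α + s) - (((+ 1 + k) + e) + ((+ 1 + k) + e))) * x
    lemma = solve-∀

  ∣ₘ-updateAt-suc : ∀ {n} (v : Vec ℕ n) i → v ∣ₘ updateAt v i suc
  ∣ₘ-updateAt-suc (a ∷ v) zero    zero    = ℕ.n≤1+n a
  ∣ₘ-updateAt-suc (a ∷ v) zero    (suc j) = ℕ.≤-refl
  ∣ₘ-updateAt-suc (a ∷ v) (suc i) zero    = ℕ.≤-refl
  ∣ₘ-updateAt-suc (a ∷ v) (suc i) (suc j) = ∣ₘ-updateAt-suc v i j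

  ∣ₘ⇒deg≤ : ∀ {n} (u v : Vec ℕ n) → u ∣ₘ v → deg u ℕ.≤ deg v
  ∣ₘ⇒deg≤ []      []      u≤v = z≤n
  ∣ₘ⇒deg≤ (a ∷ u) (b ∷ v) u≤v = ℕ.+-mono-≤ (u≤v zero) (∣ₘ⇒deg≤ u v (λ i → u≤v (suc i)))

  ∣ₘ∧deg≡⇒≡ : ∀ {n} (u v : Vec ℕ n) → u ∣ₘ v → deg v ℕ.≤ deg u → v ≡ u
  ∣ₘ∧deg≡⇒≡ []      []      u≤v le = refl
  ∣ₘ∧deg≡⇒≡ (a ∷ u) (b ∷ v) u≤v le with squeeze (u≤v zero) (∣ₘ⇒deg≤ u v (λ i → u≤v (suc i))) le
  ... | b≤a , v≤u = cong₂ _∷_ (ℕ.≤-antisym b≤a (u≤v zero)) (∣ₘ∧deg≡⇒≡ u v (λ i → u≤v (suc i)) v≤u)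

  -- Allowing an eigenvalue `- (+ c)` in place of 0 makes induction on the degree possible. The
  -- commutator gives U D f = -(c + δ) f with δ = deg a - 2i > 0, so `D a f` satisfies the
  -- hypothesis one degree lower with `c + δ` for `c`. It vanishes there by induction, hence (c + δ)
  -- f = 0 and f = 0.
  lefschetz-eigen : ∀ {n} a i c (f : Vec ℕ n → ℤ) → i ℕ.+ i ℕ.< deg a →
    (∀ v → v ∣ₘ a → deg v ≡ i → D a (U f) v ≡ - (+ c) * f v) → ∀ v → v ∣ₘ a → deg v ≡ i → f v ≡ 0ℤ
  lefschetz-eigen {n} a i c f i<a DUf v v≤a v≡i with ℤ.i*j≡0⇒i≡0∨j≡0 (- (+ c′)) (trans (sym (UDf v v≤a v≡i)) (UDf≡0 i refl v v≤a v≡i))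
    where
    δ = deg a ℕ.∸ (i ℕ.+ i)
    c′ = c ℕ.+ δ
    UDf : ∀ v → v ∣ₘ a → deg v ≡ i → U (D a f) v ≡ - (+ c′) * f v
    UDf v v≤a refl = begin
      U (D a f) v                                                    ≡⟨ isolate (U (D a f) v) (+ deg a - (+ deg v + + deg v)) (f v) ⟩
      (U (D a f) v + (+ deg a - (+ deg v + + deg v)) * f v) - (+ deg a - (+ deg v + + deg v)) * f v
                                                                     ≡⟨ cong (_- (+ deg a - (+ deg v + + deg v)) * f v) (trans (sym (DU-UD a f v)) (DUf v v≤a refl)) ⟩
      - (+ c) * f v - (+ deg a - (+ deg v + + deg v)) * f v          ≡⟨ cong (λ x → - (+ c) * f v - x * f v) δ≡ ⟩
      - (+ c) * f v - + δ * f v                                      ≡⟨ collect (+ c) (+ δ) (f v) ⟩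
      - (+ c + + δ) * f v                                            ≡⟨ cong (λ x → - x * f v) (ℤ.pos-+ c δ) ⟨
      - (+ c′) * f v                                                 ∎
      where
      open ≡-Reasoning
      isolate : ∀ u k x → u ≡ (u + k * x) - k * x
      isolate = solve-∀
      collect : ∀ c d x → - c * x - d * x ≡ - (c + d) * x
      collect = solve-∀
      δ≡ : + deg a - (+ deg v + + deg v) ≡ + (deg a ℕ.∸ (deg v ℕ.+ deg v))
      δ≡ = trans (cong (λ x → + deg a - x) (sym (ℤ.pos-+ (deg v) (deg v))))
             (trans (ℤ.m-n≡m⊖n (deg a) (deg v ℕ.+ deg v)) (ℤ.⊖-≥ (ℕ.<⇒≤ i<a)))
    UDf≡0 : ∀ j → j ≡ i → ∀ v → v ∣ₘ a → deg v ≡ i → U (D a f) v ≡ 0ℤ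
    UDf≡0 zero    refl v v≤a v≡i = trans
      (U-cong (D a f) (λ _ → 0ℤ) v (λ w j eq → ⊥-elim (ℕ.0≢1+n (trans (sym v≡i) (trans (cong deg (sym eq)) (deg-updateAt-suc w j))))))
      (U-zero v)
    UDf≡0 (suc j) refl v v≤a v≡i = trans
      (U-cong (D a f) (λ _ → 0ℤ) v (λ { w k refl →
        lefschetz-eigen a j c′ (D a f) (ℕ.<-trans (ℕ.+-mono-< (ℕ.n<1+n j) (ℕ.n<1+n j)) i<a) eigen w
          (λ x → ℕ.≤-trans (∣ₘ-updateAt-suc w k x) (v≤a x)) (ℕ.suc-injective (trans (sym (deg-updateAt-suc w k)) v≡i)) }))
      (U-zero v)
      where
      eigen : ∀ w → w ∣ₘ a → deg w ≡ j → D a (U (D a f)) w ≡ - (+ c′) * D a f w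
      eigen w w≤a w≡j = trans
        (D-cong a (U (D a f)) (λ w → - (+ c′) * f w) w w≤a
          (λ k le → UDf (updateAt w k suc) le (trans (deg-updateAt-suc w k) (cong suc w≡j))))
        (D-scale a (- (+ c′)) f w)
  ... | inj₂ f≡0 = f≡0
  ... | inj₁ c≡0 = ⊥-elim (ℕ.<⇒≢ (ℕ.<-≤-trans (ℕ.m<n⇒0<n∸m i<a) (ℕ.m≤n+m _ c)) (sym (ℤ.+-injective (trans (sym (ℤ.neg-involutive _)) (cong -_ c≡0)))))

  lefschetz : ∀ {n} a i (f : Vec ℕ n → ℤ) → i ℕ.+ i ℕ.< deg a →
    (∀ v → v ∣ₘ a → deg v ≡ suc i → U f v ≡ 0ℤ) → ∀ v → v ∣ₘ a → deg v ≡ i → f v ≡ 0ℤ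
  lefschetz a i f i<a Uf≡0 = lefschetz-eigen a i 0 f i<a (λ v v≤a v≡i → trans
    (trans (D-cong a (U f) (λ _ → 0ℤ) v v≤a (λ j le → Uf≡0 (updateAt v j suc) le (trans (deg-updateAt-suc v j) (cong suc v≡i)))) (D-zero a v))
    (sym (ℤ.*-zeroˡ (f v))))

  -- Multiplication by the variable of index `i`, on coefficient functions.
  shift : ∀ {n} → Fin n → (Vec ℕ n → ℤ) → Vec ℕ n → ℤ
  shift zero    f (zero ∷ v)  = 0ℤ
  shift zero    f (suc k ∷ v) = f (k ∷ v)
  shift (suc i) f (k ∷ v)     = shift i (λ w → f (k ∷ w)) v

  shift-+ : ∀ {n} i (f g : Vec ℕ n → ℤ) v → shift i (λ w → f w + g w) v ≡ shift i f v + shift i g v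
  shift-+ zero    f g (zero ∷ v)  = refl
  shift-+ zero    f g (suc k ∷ v) = refl
  shift-+ (suc i) f g (k ∷ v)     = shift-+ i (λ w → f (k ∷ w)) (λ w → g (k ∷ w)) v

  shift-updateAt : ∀ {n} i (f : Vec ℕ n → ℤ) v → shift i f (updateAt v i suc) ≡ f v
  shift-updateAt zero    f (k ∷ v) = refl
  shift-updateAt (suc i) f (k ∷ v) = shift-updateAt i (λ w → f (k ∷ w)) v

  shift-support : ∀ {n} i (f : Vec ℕ n → ℤ) v → shift i f v ≡ 0ℤ ⊎ ∃[ w ] updateAt w i suc ≡ v
  shift-support zero    f (zero ∷ v)  = inj₁ refl
  shift-support zero    f (suc k ∷ v) = inj₂ (k ∷ v , refl)
  shift-support (suc i) f (k ∷ v) with shift-support i (λ w → f (k ∷ w)) v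
  ... | inj₁ eq       = inj₁ eq
  ... | inj₂ (w , eq) = inj₂ (k ∷ w , cong (k ∷_) eq)

  U-shift : ∀ {n} i (f : Vec ℕ n → ℤ) v → U (shift i f) v ≡ shift i (U f) v
  U-shift zero    f (zero ∷ v)        = U-zero v
  U-shift zero    f (suc zero ∷ v)    = ℤ.+-identityˡ (U (λ w → f (0 ∷ w)) v)
  U-shift zero    f (suc (suc k) ∷ v) = refl
  U-shift (suc i) f (zero ∷ v)        = U-shift i (λ w → f (zero ∷ w)) v
  U-shift (suc i) f (suc k ∷ v)       = trans (cong (_+_ (shift i (λ w → f (k ∷ w)) v)) (U-shift i (λ w → f (suc k ∷ w)) v))
    (sym (shift-+ i (λ w → f (k ∷ w)) (U (λ w → f (suc k ∷ w))) v))

  -- The lexicographic order and finite maxima.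

  data _≼_ : ∀ {n} → Vec ℕ n → Vec ℕ n → Set where
    []   : [] ≼ []
    less : ∀ {n a b} {u v : Vec ℕ n} → a ℕ.< b → (a ∷ u) ≼ (b ∷ v)
    next : ∀ {n a} {u v : Vec ℕ n} → u ≼ v → (a ∷ u) ≼ (a ∷ v)

  ≼-total : ∀ {n} (u v : Vec ℕ n) → u ≼ v ⊎ v ≼ u
  ≼-total []      []      = inj₁ []
  ≼-total (a ∷ u) (b ∷ v) with ℕ.<-cmp a b
  ... | tri< a<b _ _ = inj₁ (less a<b)
  ... | tri> _ _ b<a = inj₂ (less b<a)
  ... | tri≈ _ refl _ with ≼-total u v
  ...   | inj₁ le = inj₁ (next le)
  ...   | inj₂ le = inj₂ (next le)

  ≼-trans : ∀ {n} {u v w : Vec ℕ n} → u ≼ v → v ≼ w → u ≼ w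
  ≼-trans []        []        = []
  ≼-trans (less p)  (less q)  = less (ℕ.<-trans p q)
  ≼-trans (less p)  (next q)  = less p
  ≼-trans (next p)  (less q)  = less q
  ≼-trans (next p)  (next q)  = next (≼-trans p q)

  ≼-antisym : ∀ {n} {u v : Vec ℕ n} → u ≼ v → v ≼ u → u ≡ v
  ≼-antisym []       []       = refl
  ≼-antisym (less p) (less q) = ⊥-elim (ℕ.<-asym p q)
  ≼-antisym (less p) (next q) = ⊥-elim (ℕ.<-irrefl refl p)
  ≼-antisym (next p) (less q) = ⊥-elim (ℕ.<-irrefl refl q)
  ≼-antisym (next p) (next q) = cong (_ ∷_) (≼-antisym p q)

  ≼-updateAt⁻ : ∀ {n} (u v : Vec ℕ n) i → updateAt u i suc ≼ updateAt v i suc → u ≼ v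
  ≼-updateAt⁻ (a ∷ u) (b ∷ v) zero    (less p) = less (ℕ.s≤s⁻¹ p)
  ≼-updateAt⁻ (a ∷ u) (b ∷ v) zero    (next p) = next p
  ≼-updateAt⁻ (a ∷ u) (b ∷ v) (suc i) (less p) = less p
  ≼-updateAt⁻ (a ∷ u) (b ∷ v) (suc i) (next p) = next (≼-updateAt⁻ u v i p)

  pick-max : ∀ {a p r} {A : Set a} {P : Pred A p} (R : A → A → Set r) → (∀ x y → R x y ⊎ R y x) →
    (∀ {x y z} → R x y → R y z → R x z) → Decidable P → ∀ L {x} → x ∈ L → P x →
    ∃[ m ] m ∈ L × P m × (∀ y → y ∈ L → P y → R y m)
  pick-max {A = A} {P} R total trans′ P? L x∈ Px = go L (Any.map (λ { refl → Px }) x∈)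
    where
    R-refl : ∀ x → R x x
    R-refl x with total x x
    ... | inj₁ r = r
    ... | inj₂ r = r
    go : ∀ L → Any.Any P L → ∃[ m ] m ∈ L × P m × (∀ y → y ∈ L → P y → R y m)
    go (z ∷ L) any with Any.any? P? L
    go (z ∷ L) (here Pz) | no none = z , here refl , Pz , λ where
      y (here refl) _  → R-refl z
      y (there y∈)  Py → ⊥-elim (none (Any.map (λ { refl → Py }) y∈))
    go (z ∷ L) (there any) | no none = ⊥-elim (none any)
    ... | yes some with go L some | P? z
    ...   | m , m∈ , Pm , max | no ¬Pz = m , there m∈ , Pm , λ where
            y (here refl) Py → ⊥-elim (¬Pz Py)
            y (there y∈)  Py → max y y∈ Py
    ...   | m , m∈ , Pm , max | yes Pz with total z m
    ...     | inj₁ z≤m = m , there m∈ , Pm , λ where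
              y (here refl) Py → z≤m
              y (there y∈)  Py → max y y∈ Py
    ...     | inj₂ m≤z = z , here refl , Pz , λ where
              y (here refl) Py → R-refl z
              y (there y∈)  Py → trans′ (max y y∈ Py) m≤z

  sum-single : ∀ {k} (i : Fin k) (g : Fin k → ℤ) → (∀ j → j ≢ i → g j ≡ 0ℤ) → sum g ≡ g i
  sum-single {suc k} i g zeros = begin
    sum g                            ≡⟨ sum-remove {i = i} g ⟩
    g i + sum (λ j → g (punchIn i j)) ≡⟨ cong (_+_ (g i)) (trans (sum-cong-≗ (λ j → zeros (punchIn i j) (Fin.punchInᵢ≢i i j))) (sum-replicate-zero k)) ⟩
    g i + 0ℤ                         ≡⟨ ℤ.+-identityʳ (g i) ⟩
    g i                              ∎
    where open ≡-Reasoning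

  length-filter-¬ : ∀ {a p} {A : Set a} {P : Pred A p} (P? : Decidable P) L →
    length (filter P? L) ℕ.+ length (filter (¬? ∘ P?) L) ≡ length L
  length-filter-¬ P? []      = refl
  length-filter-¬ P? (x ∷ L) with P? x
  ... | yes _ = cong suc (length-filter-¬ P? L)
  ... | no  _ = trans (ℕ.+-suc _ _) (cong suc (length-filter-¬ P? L))

  lookup-injective : ∀ {a} {A : Set a} {L : List A} → Unique L → ∀ i j → List.lookup L i ≡ List.lookup L j → i ≡ j
  lookup-injective (x∉ ∷ u) zero    zero    eq = refl
  lookup-injective (x∉ ∷ u) zero    (suc j) eq = ⊥-elim (All.lookup x∉ (∈-lookup j) eq)
  lookup-injective (x∉ ∷ u) (suc i) zero    eq = ⊥-elim (All.lookup x∉ (∈-lookup i) (sym eq))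
  lookup-injective (x∉ ∷ u) (suc i) (suc j) eq = cong suc (lookup-injective u i j eq)

  ¬¬-All-Dec : ∀ {a p} {A : Set a} {P : Pred A p} (L : List A) → ¬ ¬ All (Dec ∘ P) L
  ¬¬-All-Dec []      ¬all = ¬all []
  ¬¬-All-Dec (x ∷ L) ¬all = ¬¬-excluded-middle λ d → ¬¬-All-Dec L λ ds → ¬all (d ∷ ds)

  -- Lists of monomials as subsets of the box.

  module BoxList (K : ℕ) where
    open Box K

    _∈?_ : ∀ {n} (v : Vec ℕ n) L → Dec (v ∈ L)
    _∈?_ = mem? (Vec.≡-dec ℕ._≟_)

    card-singleton-≤ : ∀ {n} (G : Vec ℕ n → Bool) x → (∀ v → G v ≡ true → v ≡ x) → card G ℕ.≤ 1
    card-singleton-≤ G [] unique with G []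
    ... | true  = ℕ.≤-refl
    ... | false = z≤n
    card-singleton-≤ {suc n} G (a ∷ x) unique = ℕ.≤-trans (ℕ.≤-reflexive (sumTo-boxSum-swap n (λ b v → ⟦ G (b ∷ v) ⟧)))
      (ℕ.≤-trans (boxSum-mono n (λ v → count-at-most-one K (λ b → G (b ∷ v)) a (λ b Gb → Vec.∷-injectiveˡ (unique _ Gb))))
        (card-singleton-≤ (λ v → G (a ∷ v)) x (λ v Gv → Vec.∷-injectiveʳ (unique _ Gv))))

    term≤boxSum : ∀ n f (v : Vec ℕ n) → deg v ℕ.< K → f v ℕ.≤ boxSum n f
    term≤boxSum zero    f []      _   = ℕ.≤-refl
    term≤boxSum (suc n) f (a ∷ v) v<K = ℕ.≤-trans (term≤boxSum n (λ w → f (a ∷ w)) v (ℕ.≤-<-trans (ℕ.m≤n+m _ a) v<K))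
      (term≤sumTo K (λ b → boxSum n (λ w → f (b ∷ w))) (ℕ.≤-<-trans (ℕ.m≤m+n a _) v<K))

    member : ∀ {n} → List (Vec ℕ n) → Vec ℕ n → Bool
    member L v = does (v ∈? L)

    member⁻ : ∀ {n} L {v : Vec ℕ n} → member L v ≡ true → v ∈ L
    member⁻ L {v} eq with v ∈? L
    ... | yes v∈ = v∈

    member⁺ : ∀ {n} L {v : Vec ℕ n} → v ∈ L → member L v ≡ true
    member⁺ L {v} v∈ = dec-true (v ∈? L) v∈

    private
      equals : ∀ {n} → Vec ℕ n → Vec ℕ n → Bool
      equals x v = does (Vec.≡-dec ℕ._≟_ v x)
      equals⁻ : ∀ {n} (x v : Vec ℕ n) → equals x v ≡ true → v ≡ x
      equals⁻ x v eq with Vec.≡-dec ℕ._≟_ v x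
      ... | yes v≡x = v≡x

    card-member-≤ : ∀ {n} (L : List (Vec ℕ n)) → card (member L) ℕ.≤ length L
    card-member-≤ {n} []      = ℕ.≤-reflexive (boxSum-zero n)
    card-member-≤ {n} (x ∷ L) = ℕ.≤-trans (boxSum-mono n pointwise) (ℕ.≤-trans (ℕ.≤-reflexive (boxSum-+ n _ _))
        (ℕ.+-mono-≤ (card-singleton-≤ (equals x) x (equals⁻ x)) (card-member-≤ L)))
      where
      pointwise : ∀ v → ⟦ member (x ∷ L) v ⟧ ℕ.≤ ⟦ equals x v ⟧ ℕ.+ ⟦ member L v ⟧
      pointwise v = ⟦∨⟧≤ (equals x v)
        where
        ⟦∨⟧≤ : ∀ a {b} → ⟦ a ∨ b ⟧ ℕ.≤ ⟦ a ⟧ ℕ.+ ⟦ b ⟧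
        ⟦∨⟧≤ true  = s≤s z≤n
        ⟦∨⟧≤ false = ℕ.≤-refl

    length≤card-member : ∀ {n} (L : List (Vec ℕ n)) → Unique L → (∀ v → v ∈ L → deg v ℕ.< K) → length L ℕ.≤ card (member L)
    length≤card-member {n} []      _        _   = z≤n
    length≤card-member {n} (x ∷ L) (x∉ ∷ u) L<K = ℕ.≤-trans
        (ℕ.+-mono-≤ (ℕ.≤-trans (ℕ.≤-reflexive (sym (cong ⟦_⟧ (dec-true (Vec.≡-dec ℕ._≟_ x x) refl)))) (term≤boxSum n (λ v → ⟦ equals x v ⟧) x (L<K x (here refl))))
          (length≤card-member L u (λ v v∈ → L<K v (there v∈))))
        (ℕ.≤-trans (ℕ.≤-reflexive (sym (boxSum-+ n (λ v → ⟦ equals x v ⟧) (λ v → ⟦ member L v ⟧)))) (boxSum-mono n pointwise))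
      where
      pointwise : ∀ v → ⟦ equals x v ⟧ ℕ.+ ⟦ member L v ⟧ ℕ.≤ ⟦ member (x ∷ L) v ⟧
      pointwise v with Vec.≡-dec ℕ._≟_ v x
      ... | no  v≢x = ℕ.≤-refl
      ... | yes refl = ℕ.≤-reflexive (cong (λ b → suc ⟦ b ⟧) (dec-false (v ∈? L) (λ v∈ → All.lookup x∉ v∈ refl)))

  -- Leading and standard monomials.

  module OrderIdeal {r} (X : List (Vec ℕ r)) (unique : Unique X)
                    (closed : ∀ M N → M ∈ X → N ∣ₘ M → N ∈ X) where

    layer : ℕ → List (Vec ℕ r)
    layer d = filter (λ M → deg M ℕ.≟ d) X

    ∈-layer⁺ : ∀ {M d} → M ∈ X → deg M ≡ d → M ∈ layer d
    ∈-layer⁺ = ∈-filter⁺ (λ M → deg M ℕ.≟ _)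

    ∈-layer⁻ : ∀ {M d} → M ∈ layer d → M ∈ X × deg M ≡ d
    ∈-layer⁻ = ∈-filter⁻ (λ M → deg M ℕ.≟ _)

    layer-unique : ∀ d → Unique (layer d)
    layer-unique d = Unique.filter⁺ (λ M → deg M ℕ.≟ d) unique

    -- M is the lexicographically largest monomial of some multiple of the sum of the variables
    -- in the monomial algebra with basis X.
    IsLeading : Vec ℕ r → Set
    IsLeading M = ∃[ q ] U q M ≢ 0ℤ × (∀ M′ → M′ ∈ X → deg M′ ≡ deg M → M ≼ M′ → M′ ≢ M → U q M′ ≡ 0ℤ)

    -- Multiply the witness by the variable. This commutes with `U` and preserves the order, and a
    -- monomial of `X` that occurs in the product comes from one of its divisors, which lies in `X`
    -- as well and is covered by the old vanishing condition.
    leading-closed : ∀ M i → IsLeading M → IsLeading (updateAt M i suc)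
    leading-closed M i (q , q≢0 , above) = shift i q , nonzero , above′
      where
      nonzero : U (shift i q) (updateAt M i suc) ≢ 0ℤ
      nonzero eq = q≢0 (trans (sym (trans (U-shift i q (updateAt M i suc)) (shift-updateAt i (U q) M))) eq)
      above′ : ∀ M′ → M′ ∈ X → deg M′ ≡ deg (updateAt M i suc) → updateAt M i suc ≼ M′ → M′ ≢ updateAt M i suc → U (shift i q) M′ ≡ 0ℤ
      above′ M′ M′∈ deg≡ M≼ M≢ with shift-support i (U q) M′
      ... | inj₁ eq = trans (U-shift i q M′) eq
      ... | inj₂ (N , refl) = trans (U-shift i q M′) (trans (shift-updateAt i (U q) N)
        (above N (closed _ N M′∈ (∣ₘ-updateAt-suc N i))
          (ℕ.suc-injective (trans (sym (deg-updateAt-suc N i)) (trans deg≡ (deg-updateAt-suc M i))))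
          (≼-updateAt⁻ M N i M≼) (λ { refl → M≢ refl })))

    -- Being a leading monomial is not decided; the inequalities to be proved are stable under
    -- double negation, so it may be assumed decidable.
    module Classical (leading? : ∀ M → Dec (M ∈ X × IsLeading M)) where

      leading standard : ℕ → List (Vec ℕ r)
      leading  d = filter leading? (layer d)
      standard d = filter (¬? ∘ leading?) (layer d)

      ∈-leading⁻ : ∀ {M d} → M ∈ leading d → M ∈ X × deg M ≡ d × IsLeading M
      ∈-leading⁻ {M} {d} M∈ with ∈-filter⁻ leading? {xs = layer d} M∈
      ... | M∈layer , _ , lead = proj₁ (∈-layer⁻ M∈layer) , proj₂ (∈-layer⁻ M∈layer) , lead

      leading-unique : ∀ d → Unique (leading d)
      leading-unique d = Unique.filter⁺ leading? (layer-unique d)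

      standard-unique : ∀ d → Unique (standard d)
      standard-unique d = Unique.filter⁺ (¬? ∘ leading?) (layer-unique d)

      leading+standard : ∀ d → length (leading d) ℕ.+ length (standard d) ≡ length (layer d)
      leading+standard d = length-filter-¬ leading? (layer d)

      -- A relation among polynomials with distinct leading monomials is trivial.
      leading≤layer : ∀ d → length (leading (suc d)) ℕ.≤ length (layer d)
      leading≤layer d = ℕ.≮⇒≥ impossible
        where
        N : Fin (length (leading (suc d))) → Vec ℕ r
        N j = List.lookup (leading (suc d)) j
        lead : ∀ j → IsLeading (N j)
        lead j = proj₂ (proj₂ (∈-leading⁻ {d = suc d} (∈-lookup j)))
        N∈X : ∀ j → N j ∈ X
        N∈X j = proj₁ (∈-leading⁻ {d = suc d} (∈-lookup j))
        deg-N : ∀ j → deg (N j) ≡ suc d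
        deg-N j = proj₁ (proj₂ (∈-leading⁻ {d = suc d} (∈-lookup j)))
        q : Fin (length (leading (suc d))) → Vec ℕ r → ℤ
        q j = proj₁ (lead j)
        impossible : ¬ (length (layer d) ℕ.< length (leading (suc d)))
        impossible lt with linear-relation (length (layer d)) (λ j i → q j (List.lookup (layer d) i)) lt
        ... | c , (j₀ , c≢0) , rel with pick-max (λ j k → N j ≼ N k) (λ j k → ≼-total (N j) (N k)) ≼-trans
                                          (λ j → ¬? (c j ℤ.≟ 0ℤ)) (allFin _) (∈-allFin j₀) c≢0
        ...   | m , _ , cm≢0 , max with ℤ.i*j≡0⇒i≡0∨j≡0 (c m) (trans (sym (sum-single m (λ j → c j * U (q j) (N m)) others)) Up≡0)
          where
          p : Vec ℕ r → ℤ
          p w = sum (λ j → c j * q j w)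
          p≡0 : ∀ w → w ∈ X → deg w ≡ d → p w ≡ 0ℤ
          p≡0 w w∈ w≡d = subst (λ x → p x ≡ 0ℤ) (sym (lookup-index (∈-layer⁺ w∈ w≡d))) (rel (index (∈-layer⁺ w∈ w≡d)))
          -- `U p` at `N m` reads `p` only at divisors of degree `d`; they belong to `X`, where the
          -- relation makes `p` vanish.
          Up≡0 : sum (λ j → c j * U (q j) (N m)) ≡ 0ℤ
          Up≡0 = trans (sym (U-sum c q (N m))) (trans (U-cong p (λ _ → 0ℤ) (N m) (λ w i eq →
            p≡0 w (closed (N m) w (N∈X m) (subst (w ∣ₘ_) eq (∣ₘ-updateAt-suc w i)))
              (ℕ.suc-injective (trans (sym (deg-updateAt-suc w i)) (trans (cong deg eq) (deg-N m)))))) (U-zero (N m)))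
          others : ∀ j → j ≢ m → c j * U (q j) (N m) ≡ 0ℤ
          others j j≢m with c j ℤ.≟ 0ℤ
          ... | yes c≡0 = trans (cong (_* U (q j) (N m)) c≡0) (ℤ.*-zeroˡ (U (q j) (N m)))
          ... | no  c≢0 = trans (cong (c j *_) (proj₂ (proj₂ (lead j)) (N m) (N∈X m) (trans (deg-N m) (sym (deg-N j))) (max j (∈-allFin j) c≢0)
                            (λ eq → j≢m (sym (lookup-injective (leading-unique (suc d)) m j eq))))) (ℤ.*-zeroʳ (c j))
        ...     | inj₁ c≡0  = cm≢0 c≡0
        ...     | inj₂ Uq≡0 = proj₁ (proj₂ (lead m)) Uq≡0

      -- Were there fewer leading monomials of degree `suc d`, some nonzero combination `f` of
      -- `layer d` would have `U f` zero at all of them. The largest monomial of a nonzero `U f` is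
      -- leading, so `U f` vanishes on `X` in that degree, and injectivity contradicts the choice of
      -- `f`.
      layer≤leading : ∀ d →
        (∀ f → (∀ M → M ∈ X → deg M ≡ suc d → U f M ≡ 0ℤ) → ∀ M → M ∈ X → deg M ≡ d → f M ≡ 0ℤ) →
        length (layer d) ℕ.≤ length (leading (suc d))
      layer≤leading d U-injective = ℕ.≮⇒≥ impossible
        where
        N : Fin (length (layer d)) → Vec ℕ r
        N i = List.lookup (layer d) i
        e : Fin (length (layer d)) → Vec ℕ r → ℤ
        e i w = if does (Vec.≡-dec ℕ._≟_ w (N i)) then 1ℤ else 0ℤ
        impossible : ¬ (length (leading (suc d)) ℕ.< length (layer d))
        impossible lt with linear-relation (length (leading (suc d))) (λ i j → U (e i) (List.lookup (leading (suc d)) j)) lt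
        ... | c , (i₀ , c≢0) , rel = c≢0 (trans (sym f≡c) (U-injective f Uf≡0 (N i₀) (proj₁ (∈-layer⁻ (∈-lookup i₀))) (proj₂ (∈-layer⁻ {d = d} (∈-lookup i₀)))))
          where
          f : Vec ℕ r → ℤ
          f w = sum (λ i → c i * e i w)
          f≡c : f (N i₀) ≡ c i₀
          f≡c = trans (sum-single i₀ (λ i → c i * e i (N i₀)) (λ i i≢ → trans
              (cong (λ b → c i * (if b then 1ℤ else 0ℤ)) (dec-false (Vec.≡-dec ℕ._≟_ (N i₀) (N i)) (λ eq → i≢ (sym (lookup-injective (layer-unique d) i₀ i eq)))))
              (ℤ.*-zeroʳ (c i))))
            (trans (cong (λ b → c i₀ * (if b then 1ℤ else 0ℤ)) (dec-true (Vec.≡-dec ℕ._≟_ (N i₀) (N i₀)) refl)) (ℤ.*-identityʳ (c i₀)))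
          Uf≡0 : ∀ M → M ∈ X → deg M ≡ suc d → U f M ≡ 0ℤ
          Uf≡0 M M∈ M≡ with U f M ℤ.≟ 0ℤ
          ... | yes eq = eq
          ... | no  ne with pick-max _≼_ ≼-total ≼-trans (λ M → ¬? (U f M ℤ.≟ 0ℤ)) (layer (suc d)) (∈-layer⁺ M∈ M≡) ne
          ...   | L , L∈ , Lne , max = ⊥-elim (Lne (trans (cong (U f) (lookup-index L∈leading)) (trans (U-sum c e (List.lookup (leading (suc d)) (index L∈leading))) (rel (index L∈leading)))))
            where
            L∈leading : L ∈ leading (suc d)
            L∈leading = ∈-filter⁺ leading? L∈ (proj₁ (∈-layer⁻ L∈) , f , Lne , λ M′ M′∈ deg≡ L≼ M′≢ →
              decidable-stable (U f M′ ℤ.≟ 0ℤ) (λ ne′ → M′≢ (≼-antisym (max M′ (∈-layer⁺ M′∈ (trans deg≡ (proj₂ (∈-layer⁻ L∈)))) ne′) L≼)))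

      -- The standard monomials form an order ideal, by leading-closed.
      standard-macaulay : ∀ d c → length (standard (suc d)) ℕ.≤ c → length (standard (suc (suc d))) ℕ.≤ macaulayBound (suc d) c
      standard-macaulay d c le = ℕ.≤-trans
          (length≤card-member (standard (suc (suc d))) (standard-unique (suc (suc d))) (λ v v∈ → ℕ.s≤s (ℕ.≤-reflexive (deg-standard v∈))))
          (macaulay d c (member (standard (suc (suc d)))) (member (standard (suc d))) ℕ.≤-refl
            (λ v v∈ → deg-standard (member⁻ (standard (suc (suc d))) v∈))
            (λ v i v∈ → member⁺ (standard (suc d)) (down v i (member⁻ (standard (suc (suc d))) v∈)))
            (ℕ.≤-trans (card-member-≤ (standard (suc d))) le))
        where
        open Box (suc (suc (suc d)))
        open BoxList (suc (suc (suc d)))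
        deg-standard : ∀ {v k} → v ∈ standard k → deg v ≡ k
        deg-standard {k = k} v∈ = proj₂ (∈-layer⁻ {d = k} (proj₁ (∈-filter⁻ (¬? ∘ leading?) {xs = layer k} v∈)))
        down : ∀ v i → updateAt v i suc ∈ standard (suc (suc d)) → v ∈ standard (suc d)
        down v i v∈ with ∈-filter⁻ (¬? ∘ leading?) {xs = layer (suc (suc d))} v∈
        ... | v∈layer , ¬lead = ∈-filter⁺ (¬? ∘ leading?)
          (∈-layer⁺ (closed _ v (proj₁ (∈-layer⁻ v∈layer)) (∣ₘ-updateAt-suc v i))
                    (ℕ.suc-injective (trans (sym (deg-updateAt-suc v i)) (proj₂ (∈-layer⁻ {d = suc (suc d)} v∈layer)))))
          (λ { (_ , lead) → ¬lead (proj₁ (∈-layer⁻ v∈layer) , leading-closed v i lead) })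

    -- Excluded middle can be collected under a double negation over a finite list but not over all
    -- monomials. The conjunct `M ∈ X` reduces the question to the list `X`.
    ¬¬-leading? : ¬ ¬ (∀ M → Dec (M ∈ X × IsLeading M))
    ¬¬-leading? ¬dec = ¬¬-All-Dec X λ decs → ¬dec λ M → decide decs M (mem? (Vec.≡-dec ℕ._≟_) M X)
      where
      decide : All (Dec ∘ IsLeading) X → ∀ M → Dec (M ∈ X) → Dec (M ∈ X × IsLeading M)
      decide decs M (no M∉)  = no (M∉ ∘ proj₁)
      decide decs M (yes M∈) = map′ (M∈ ,_) proj₂ (All.lookup decs M∈)

  -- Differences in the first half of a pure order ideal.

  module PureOrderIdeal {r} (X : List (Vec ℕ r)) (E : ℕ) (pure : IsPureOrderIdeal X E) where
    private
      unique = proj₁ (proj₁ pure)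
      closed = proj₂ (proj₂ (proj₁ pure))
    open OrderIdeal X unique closed

    -- Among the multiples of `M` in `X`, one of largest degree is maximal for divisibility, because
    -- any multiple of it in `X` is again a multiple of `M`. Purity then fixes its degree.
    below-top : ∀ M → M ∈ X → ∃[ T ] T ∈ X × M ∣ₘ T × deg T ≡ E
    below-top M M∈ with pick-max (λ N N′ → deg N ℕ.≤ deg N′) (λ N N′ → ℕ.≤-total (deg N) (deg N′)) ℕ.≤-trans
                          (λ N → Fin.all? (λ i → lookup M i ℕ.≤? lookup N i)) X M∈ (λ i → ℕ.≤-refl)
    ... | T , T∈ , M≤T , max = T , T∈ , M≤T , proj₂ pure T (T∈ , λ N N∈ T≤N →
            ∣ₘ∧deg≡⇒≡ T N T≤N (max N N∈ (λ i → ℕ.≤-trans (M≤T i) (T≤N i))))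

    U-injective : ∀ d → d ℕ.+ d ℕ.< E → ∀ f → (∀ M → M ∈ X → deg M ≡ suc d → U f M ≡ 0ℤ) → ∀ M → M ∈ X → deg M ≡ d → f M ≡ 0ℤ
    U-injective d 2d<E f Uf≡0 M M∈ M≡ with below-top M M∈
    ... | T , T∈ , M≤T , T≡ = lefschetz T d f (subst (d ℕ.+ d ℕ.<_) (sym T≡) 2d<E)
            (λ v v≤T → Uf≡0 v (closed T v T∈ v≤T)) M M≤T M≡

    countDeg-mono : ∀ d → d ℕ.+ d ℕ.< E → countDeg X d ℕ.≤ countDeg X (suc d)
    countDeg-mono d 2d<E = decidable-stable (countDeg X d ℕ.≤? countDeg X (suc d)) λ ¬le → ¬¬-leading? λ leading? →
      let open Classical leading? in
      ¬le (ℕ.≤-trans (layer≤leading d (U-injective d 2d<E)) (ℕ.≤-trans (ℕ.m≤m+n _ _) (ℕ.≤-reflexive (leading+standard (suc d)))))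

    -- The image of ℓ in degree d + 2 has dimension at most `countDeg X (suc d)`, so the left side
    -- is at most the number of standard monomials there. By injectivity in degree `d`, the standard
    -- monomials of degree d + 1 number at most the argument on the right.
    difference-macaulay : ∀ d → d ℕ.+ d ℕ.< E →
      countDeg X (suc (suc d)) ℕ.∸ countDeg X (suc d) ℕ.≤ macaulayBound (suc d) (countDeg X (suc d) ℕ.∸ countDeg X d)
    difference-macaulay d 2d<E = decidable-stable (_ ℕ.≤? _) λ ¬le → ¬¬-leading? λ leading? →
      let open Classical leading? in
      ¬le (ℕ.≤-trans
        (ℕ.m≤n+o⇒m∸n≤o (countDeg X (suc (suc d))) (countDeg X (suc d)) (ℕ.≤-trans (ℕ.≤-reflexive (sym (leading+standard (suc (suc d)))))
          (ℕ.+-monoˡ-≤ (length (standard (suc (suc d)))) (leading≤layer (suc d)))))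
        (standard-macaulay d _ (ℕ.m+n≤o⇒m≤o∸n (length (standard (suc d))) (ℕ.≤-trans
          (ℕ.+-monoʳ-≤ (length (standard (suc d))) (layer≤leading d (U-injective d 2d<E)))
          (ℕ.≤-reflexive (trans (ℕ.+-comm (length (standard (suc d))) (length (leading (suc d)))) (leading+standard (suc d))))))))

-- Lexicographic segments.

module FirstHalves where

  open Macaulay
  open PureIdeals
  open import Data.Nat
  open import Data.Nat.Properties
  open import Data.Nat.Combinatorics using (_C_; nC1≡n)
  open import Data.Nat.DivMod using (m*n/n≡m; m/n*n≤m)
  open import Data.Fin using (Fin; zero; suc; toℕ; fromℕ<)
  import Data.Fin.Properties as Fin
  open import Data.Vec using (Vec; []; _∷_; lookup; updateAt; replicate; tabulate)
  import Data.Vec.Properties as Vec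
  open import Data.List using (List; []; _∷_; _++_; length; filter; map; take)
  open import Data.List.Properties using (length-++; length-map; length-take; take-map; filter-++; filter-all; filter-none)
  open import Data.List.Membership.Propositional using (_∈_)
  open import Data.List.Membership.Propositional.Properties using (∈-map⁺; ∈-map⁻; ∈-++⁺ˡ; ∈-++⁺ʳ; ∈-++⁻)
  open import Data.List.Relation.Unary.Any using (here; there)
  open import Data.List.Relation.Unary.All as All using ([])
  open import Data.List.Relation.Unary.AllPairs using ([]; _∷_)
  open import Data.List.Relation.Unary.Unique.Propositional using (Unique)
  import Data.List.Relation.Unary.Unique.Propositional.Properties as Unique
  open import Data.Product using (_×_; _,_; proj₁; proj₂; ∃-syntax)
  open import Data.Sum using (inj₁; inj₂)
  open import Data.Empty using (⊥-elim)
  open import Relation.Nullary using (¬_; yes; no)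
  open import Relation.Binary.PropositionalEquality

  take-length-+ : ∀ {a} {A : Set a} (xs ys : List A) k → take (length xs + k) (xs ++ ys) ≡ xs ++ take k ys
  take-length-+ []       ys k = refl
  take-length-+ (x ∷ xs) ys k = cong (x ∷_) (take-length-+ xs ys k)

  take-++-≤ : ∀ {a} {A : Set a} k (xs ys : List A) → k ≤ length xs → take k (xs ++ ys) ≡ take k xs
  take-++-≤ zero    xs       ys _        = refl
  take-++-≤ (suc k) (x ∷ xs) ys (s≤s k≤) = cong (x ∷_) (take-++-≤ k xs ys k≤)

  ∈-take-++ : ∀ {a} {A : Set a} k {x} (xs ys : List A) → x ∈ take k xs → x ∈ take k (xs ++ ys)
  ∈-take-++ (suc k) (x ∷ xs) ys (here eq)  = here eq
  ∈-take-++ (suc k) (x ∷ xs) ys (there x∈) = there (∈-take-++ k xs ys x∈)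

  ∈-take-mono : ∀ {a} {A : Set a} {k l x} (xs : List A) → k ≤ l → x ∈ take k xs → x ∈ take l xs
  ∈-take-mono (x ∷ xs) (s≤s k≤l) (here eq)  = here eq
  ∈-take-mono (x ∷ xs) (s≤s k≤l) (there x∈) = there (∈-take-mono xs k≤l x∈)

  ∈-take⁻ : ∀ {a} {A : Set a} k {x} (xs : List A) → x ∈ take k xs → x ∈ xs
  ∈-take⁻ (suc k) (x ∷ xs) (here eq)  = here eq
  ∈-take⁻ (suc k) (x ∷ xs) (there x∈) = there (∈-take⁻ k xs x∈)

  sucHead : ∀ {n} → Vec ℕ (suc n) → Vec ℕ (suc n)
  sucHead v = updateAt v zero suc

  -- The monomials of degree d in n variables, in increasing lexicographic order.
  monomials : ∀ n (d : ℕ) → List (Vec ℕ n)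
  monomials zero    zero    = [] ∷ []
  monomials zero    (suc d) = []
  monomials (suc n) zero    = replicate (suc n) 0 ∷ []
  monomials (suc n) (suc d) = map (0 ∷_) (monomials n (suc d)) ++ map sucHead (monomials (suc n) d)

  monomials-deg : ∀ n d {v} → v ∈ monomials n d → deg v ≡ d
  monomials-deg zero    zero    (here refl) = refl
  monomials-deg (suc n) zero    (here refl) = deg-replicate n
    where
    deg-replicate : ∀ n → deg (replicate n 0) ≡ 0
    deg-replicate zero    = refl
    deg-replicate (suc n) = deg-replicate n
  monomials-deg (suc n) (suc d) v∈ with ∈-++⁻ (map (0 ∷_) (monomials n (suc d))) v∈
  ... | inj₁ v∈₀ with _ , w∈ , refl ← ∈-map⁻ (0 ∷_) v∈₀ = monomials-deg n (suc d) w∈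
  ... | inj₂ v∈₁ with (a ∷ w) , w∈ , refl ← ∈-map⁻ sucHead v∈₁ = cong suc (monomials-deg (suc n) d w∈)

  monomials-complete : ∀ {n} (v : Vec ℕ n) → v ∈ monomials n (deg v)
  monomials-complete [] = here refl
  monomials-complete (suc a ∷ v) = ∈-++⁺ʳ (map (0 ∷_) (monomials _ (suc (a + deg v)))) (∈-map⁺ sucHead (monomials-complete (a ∷ v)))
  monomials-complete (zero ∷ v) = prepend (deg v) (monomials-complete v)
    where
    prepend : ∀ {n} d {v : Vec ℕ n} → v ∈ monomials n d → (0 ∷ v) ∈ monomials (suc n) d
    prepend {zero}  zero    (here refl) = here refl
    prepend {suc n} zero    (here refl) = here refl
    prepend (suc d) v∈ = ∈-++⁺ˡ (∈-map⁺ (0 ∷_) v∈)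

  monomials-unique : ∀ n d → Unique (monomials n d)
  monomials-unique zero    zero    = [] ∷ []
  monomials-unique zero    (suc d) = []
  monomials-unique (suc n) zero    = [] ∷ []
  monomials-unique (suc n) (suc d) = Unique.++⁺
    (Unique.map⁺ Vec.∷-injectiveʳ (monomials-unique n (suc d)))
    (Unique.map⁺ sucHead-injective (monomials-unique (suc n) d))
    disjoint
    where
    sucHead-injective : ∀ {u v : Vec ℕ (suc n)} → sucHead u ≡ sucHead v → u ≡ v
    sucHead-injective {a ∷ u} {b ∷ v} refl = refl
    disjoint : ∀ {v} → ¬ (v ∈ map (0 ∷_) (monomials n (suc d)) × v ∈ map sucHead (monomials (suc n) d))
    disjoint (v∈₀ , v∈₁) with ∈-map⁻ (0 ∷_) v∈₀ | ∈-map⁻ sucHead v∈₁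
    ... | _ , _ , refl | (_ ∷ _) , _ , ()

  length-monomials : ∀ n d → length (monomials (suc n) d) ≡ (n + d) C d
  length-monomials-suc : ∀ n d → length (monomials n (suc d)) ≡ (n + d) C suc d

  length-monomials n zero    = sym (nC0≡1 (n + 0))
  length-monomials n (suc d) = begin
    length (map (0 ∷_) (monomials n (suc d)) ++ map sucHead (monomials (suc n) d))
      ≡⟨ trans (length-++ (map (0 ∷_) (monomials n (suc d)))) (cong₂ _+_ (length-map (0 ∷_) (monomials n (suc d))) (length-map sucHead (monomials (suc n) d))) ⟩
    length (monomials n (suc d)) + length (monomials (suc n) d)
      ≡⟨ cong₂ _+_ (length-monomials-suc n d) (length-monomials n d) ⟩
    (n + d) C suc d + (n + d) C d ≡⟨ pascal (n + d) d ⟨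
    suc (n + d) C suc d           ≡⟨ cong (_C suc d) (+-suc n d) ⟨
    (n + suc d) C suc d           ∎
    where open ≡-Reasoning
  length-monomials-suc zero    d = sym (nC[1+n]≡0 d)
  length-monomials-suc (suc n) d = trans (length-monomials n (suc d)) (cong (_C suc d) (+-suc n d))

  -- Needed when a segment element is divided by the first variable: the quotient is among the first
  -- `b` monomials of its degree and has to be among the first `(n + d) C suc d + c`.
  bound≤ : ∀ {n d c b} → Expansion (suc n) d c b → b ≤ (n + d) C suc d + c
  bound≤ [] = z≤n
  bound≤ {n} (_∷_ {x = x} {d} {c} {b} x<n ε) = begin
    (x + suc d) C suc (suc d) + b                              ≤⟨ +-monoʳ-≤ ((x + suc d) C suc (suc d)) (bound≤ ε) ⟩
    (x + suc d) C suc (suc d) + ((x + d) C suc d + c)          ≤⟨ +-monoˡ-≤ ((x + d) C suc d + c) (C-monoˡ-≤ (suc (suc d)) (+-monoˡ-≤ (suc d) (s≤s⁻¹ x<n))) ⟩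
    (n + suc d) C suc (suc d) + ((x + d) C suc d + c)          ∎
    where open ≤-Reasoning

  segment-closed : ∀ n {d c b} → Expansion (suc n) d c b → ∀ v i →
    updateAt v i suc ∈ take b (monomials (suc n) (suc d)) → v ∈ take c (monomials (suc n) d)
  segment-closed n [] v i ()
  segment-closed n (_∷_ {x = x} {d} {c} {b} x<n ε) v i u∈ with x ≟ n
  segment-closed n (_∷_ {x = x} {d} {c} {b} x<n ε) v i u∈ | yes refl = result
    where
    A = map (0 ∷_) (monomials n (suc d))
    A⁺ = map (0 ∷_) (monomials n (suc (suc d)))
    value-split : take ((n + d) C suc d + c) (monomials (suc n) (suc d)) ≡ A ++ map sucHead (take c (monomials (suc n) d))
    value-split = trans (cong (λ k → take (k + c) (monomials (suc n) (suc d))) (trans (sym (length-monomials-suc n d)) (sym (length-map (0 ∷_) (monomials n (suc d))))))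
      (trans (take-length-+ A (map sucHead (monomials (suc n) d)) c) (cong (A ++_) (take-map c (monomials (suc n) d))))
    bound-split : take ((n + suc d) C suc (suc d) + b) (monomials (suc n) (suc (suc d))) ≡ A⁺ ++ map sucHead (take b (monomials (suc n) (suc d)))
    bound-split = trans (cong (λ k → take (k + b) (monomials (suc n) (suc (suc d)))) (trans (sym (length-monomials-suc n (suc d))) (sym (length-map (0 ∷_) (monomials n (suc (suc d)))))))
      (trans (take-length-+ A⁺ (map sucHead (monomials (suc n) (suc d))) b) (cong (A⁺ ++_) (take-map b (monomials (suc n) (suc d)))))
    lowered : ∀ v i → (∃[ w ] w ∈ take b (monomials (suc n) (suc d)) × updateAt v i suc ≡ sucHead w) →
              v ∈ take ((n + d) C suc d + c) (monomials (suc n) (suc d))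
    lowered (a ∷ v) zero    ((_ ∷ _) , w∈ , refl) = ∈-take-mono (monomials (suc n) (suc d)) (bound≤ ε) w∈
    lowered (a ∷ v) (suc i) ((a′ ∷ _) , w∈ , refl) = subst ((suc a′ ∷ v) ∈_) (sym value-split)
      (∈-++⁺ʳ A (∈-map⁺ sucHead (segment-closed n ε (a′ ∷ v) (suc i) w∈)))
    zero-head : ∀ v i → (∃[ w ] w ∈ monomials n (suc (suc d)) × updateAt v i suc ≡ 0 ∷ w) →
                v ∈ take ((n + d) C suc d + c) (monomials (suc n) (suc d))
    zero-head (a ∷ v) (suc i) (_ , w∈ , refl) = subst ((0 ∷ v) ∈_) (sym value-split) (∈-++⁺ˡ (∈-map⁺ (0 ∷_)
      (subst (λ k → v ∈ monomials n k) (suc-injective (trans (sym (deg-updateAt-suc v i)) (monomials-deg n (suc (suc d)) w∈))) (monomials-complete v))))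
    zero-head (a ∷ v) zero (_ , w∈ , ())
    result : v ∈ take ((n + d) C suc d + c) (monomials (suc n) (suc d))
    result with ∈-++⁻ A⁺ (subst (updateAt v i suc ∈_) bound-split u∈)
    ... | inj₁ u∈₀ = zero-head v i (∈-map⁻ (0 ∷_) u∈₀)
    ... | inj₂ u∈₁ = lowered v i (∈-map⁻ sucHead u∈₁)
  segment-closed zero (_∷_ {x = x} (s≤s x≤n) ε) v i u∈ | no x≢n = ⊥-elim (x≢n (n≤0⇒n≡0 x≤n))
  segment-closed (suc n) (_∷_ {x = x} {d} {c} {b} x<n ε) v i u∈ | no x≢n =
      zero-head v i (∈-map⁻ (0 ∷_) (subst (updateAt v i suc ∈_) bound-split u∈))
    where
    C₀ = (x + d) C suc d + c
    B₀ = (x + suc d) C suc (suc d) + b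
    ε′ : Expansion (suc n) (suc d) C₀ B₀
    ε′ = ≤∧≢⇒< (s≤s⁻¹ x<n) x≢n ∷ ε
    A⁺ = map (0 ∷_) (monomials (suc n) (suc (suc d)))
    bound-split : take B₀ (monomials (suc (suc n)) (suc (suc d))) ≡ map (0 ∷_) (take B₀ (monomials (suc n) (suc (suc d))))
    bound-split = trans (take-++-≤ B₀ A⁺ (map sucHead (monomials (suc (suc n)) (suc d)))
        (≤-trans (<⇒≤ (bound-< ε′)) (≤-reflexive (trans (sym (length-monomials n (suc (suc d)))) (sym (length-map (0 ∷_) (monomials (suc n) (suc (suc d)))))))))
      (take-map B₀ (monomials (suc n) (suc (suc d))))
    zero-head : ∀ v i → (∃[ w ] w ∈ take B₀ (monomials (suc n) (suc (suc d))) × updateAt v i suc ≡ 0 ∷ w) →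
                v ∈ take C₀ (monomials (suc (suc n)) (suc d))
    zero-head (a ∷ v) zero    (_ , w∈ , ())
    zero-head (a ∷ v) (suc i) (_ , w∈ , refl) = ∈-take-++ C₀ (map (0 ∷_) (monomials (suc n) (suc d))) (map sucHead (monomials (suc (suc n)) d))
      (subst ((0 ∷ v) ∈_) (sym (take-map C₀ (monomials (suc n) (suc d)))) (∈-map⁺ (0 ∷_) (segment-closed n ε′ v i w∈)))

  ∣ₘ-closed : ∀ {n} (P : Vec ℕ n → Set) → (∀ v i → P (updateAt v i suc) → P v) → ∀ u v → u ∣ₘ v → P v → P u
  ∣ₘ-closed P down []      []      u≤v Pv = Pv
  ∣ₘ-closed P down (a ∷ u) (b ∷ v) u≤v Pv =
    ∣ₘ-closed (λ w → P (a ∷ w)) (λ w i → down (a ∷ w) (suc i)) u v (λ i → u≤v (suc i)) (lower (≤⇒≤′ (u≤v zero)) Pv)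
    where
    lower : ∀ {b} → a ≤′ b → P (b ∷ v) → P (a ∷ v)
    lower ≤′-refl       p = p
    lower (≤′-step a≤b) p = lower a≤b (down _ zero p)

  -- Families of monomials assembled from homogeneous pieces.

  module Graded {n} (L : ℕ → List (Vec ℕ n)) (homogeneous : ∀ d {v} → v ∈ L d → deg v ≡ d) (L-unique : ∀ d → Unique (L d)) where

    upTo : ℕ → List (Vec ℕ n)
    upTo zero    = L 0
    upTo (suc k) = L (suc k) ++ upTo k

    ∈-upTo⁻ : ∀ k {v} → v ∈ upTo k → deg v ≤ k × v ∈ L (deg v)
    ∈-upTo⁻ zero    v∈ = ≤-reflexive (homogeneous 0 v∈) , subst (λ d → _ ∈ L d) (sym (homogeneous 0 v∈)) v∈
    ∈-upTo⁻ (suc k) v∈ with ∈-++⁻ (L (suc k)) v∈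
    ... | inj₁ v∈L = ≤-reflexive (homogeneous (suc k) v∈L) , subst (λ d → _ ∈ L d) (sym (homogeneous (suc k) v∈L)) v∈L
    ... | inj₂ v∈k = m≤n⇒m≤1+n (proj₁ (∈-upTo⁻ k v∈k)) , proj₂ (∈-upTo⁻ k v∈k)

    ∈-upTo⁺ : ∀ k {v} → deg v ≤ k → v ∈ L (deg v) → v ∈ upTo k
    ∈-upTo⁺ zero    {v} v≤ v∈ = subst (λ d → v ∈ L d) (n≤0⇒n≡0 v≤) v∈
    ∈-upTo⁺ (suc k) {v} v≤ v∈ with deg v ≟ suc k
    ... | yes eq = ∈-++⁺ˡ (subst (λ d → v ∈ L d) eq v∈)
    ... | no  ne = ∈-++⁺ʳ (L (suc k)) (∈-upTo⁺ k (s≤s⁻¹ (≤∧≢⇒< v≤ ne)) v∈)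

    upTo-unique : ∀ k → Unique (upTo k)
    upTo-unique zero    = L-unique 0
    upTo-unique (suc k) = Unique.++⁺ (L-unique (suc k)) (upTo-unique k)
      (λ { (v∈L , v∈k) → <⇒≱ (s≤s (proj₁ (∈-upTo⁻ k v∈k))) (≤-reflexive (sym (homogeneous (suc k) v∈L))) })

    countDeg-upTo : ∀ k i → i ≤ k → countDeg (upTo k) i ≡ length (L i)
    countDeg-upTo k i i≤k = go k i≤k
      where
      same : filter (λ v → deg v ≟ i) (L i) ≡ L i
      same = filter-all (λ v → deg v ≟ i) (All.tabulate (homogeneous i))
      above : ∀ k → k < i → filter (λ v → deg v ≟ i) (upTo k) ≡ []
      above k k<i = filter-none (λ v → deg v ≟ i) (All.tabulate (λ v∈ eq → <⇒≱ k<i (subst (_≤ k) eq (proj₁ (∈-upTo⁻ k v∈)))))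
      go : ∀ k → i ≤ k → countDeg (upTo k) i ≡ length (L i)
      go zero z≤n = cong length same
      go (suc k) i≤ with i ≟ suc k
      ... | yes refl = trans (cong length (filter-++ (λ v → deg v ≟ i) (L i) (upTo k)))
                         (trans (length-++ (filter (λ v → deg v ≟ i) (L i)))
                           (trans (cong₂ _+_ (cong length same) (cong length (above k ≤-refl))) (+-identityʳ (length (L i)))))
      ... | no i≢ = trans (cong length (filter-++ (λ v → deg v ≟ i) (L (suc k)) (upTo k)))
                      (trans (cong (λ l → length (l ++ filter (λ v → deg v ≟ i) (upTo k)))
                        (filter-none (λ v → deg v ≟ i) (All.tabulate (λ v∈ eq → i≢ (trans (sym eq) (homogeneous (suc k) v∈))))))
                        (go k (s≤s⁻¹ (≤∧≢⇒< i≤ i≢))))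

  -- The pure order ideal of a differentiable sequence.

  module Construction (e : ℕ) (g : ℕ → ℕ) (g0 : g 0 ≡ 1) (g-macaulay : ∀ d → 1 ≤ d → d < e → g (suc d) ≤ macaulayBound d (g d)) where

    -- One variable more than `g 1` makes the inequality strict in degree 1, as `expand` demands;
    -- `bound-<` carries strictness to higher degrees.
    g<count : ∀ d → suc d ≤ e → g (suc d) < (g 1 + suc d) C suc d
    g<count zero    _   = ≤-reflexive (sym (trans (nC1≡n (g 1 + 1)) (+-comm (g 1) 1)))
    g<count (suc d) d<e with expand (g 1) (suc d) (g (suc d)) (g<count d (<⇒≤ d<e))
    ... | b , ε = ≤-<-trans (≤-trans (g-macaulay (suc d) (s≤s z≤n) d<e) (≤-reflexive (macaulayBound≡bound ε))) (bound-< ε)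

    segment : ℕ → List (Vec ℕ (suc (g 1)))
    segment d = take (g d) (monomials (suc (g 1)) d)

    segment-deg : ∀ d {v} → v ∈ segment d → deg v ≡ d
    segment-deg d v∈ = monomials-deg (suc (g 1)) d (∈-take⁻ (g d) (monomials (suc (g 1)) d) v∈)

    length-segment : ∀ d → d ≤ e → length (segment d) ≡ g d
    length-segment zero    _   = trans (cong (λ k → length (take k (monomials (suc (g 1)) 0))) g0) (sym g0)
    length-segment (suc d) d<e = trans (length-take (g (suc d)) (monomials (suc (g 1)) (suc d)))
      (m≤n⇒m⊓n≡m (≤-trans (<⇒≤ (g<count d d<e)) (≤-reflexive (sym (length-monomials (g 1) (suc d))))))

    segment-down : ∀ d → suc d ≤ e → ∀ v i → updateAt v i suc ∈ segment (suc d) → v ∈ segment d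
    segment-down zero    _   v i v∈ = subst (λ k → v ∈ take k (monomials (suc (g 1)) 0)) (sym g0)
      (subst (λ k → v ∈ monomials (suc (g 1)) k) (suc-injective (trans (sym (deg-updateAt-suc v i)) (segment-deg 1 v∈))) (monomials-complete v))
    segment-down (suc d) d<e v i v∈ with expand (g 1) (suc d) (g (suc d)) (g<count d (<⇒≤ d<e))
    ... | b , ε = segment-closed (g 1) ε v i (∈-take-mono (monomials (suc (g 1)) (suc (suc d)))
                    (≤-trans (g-macaulay (suc d) (s≤s z≤n) d<e) (≤-reflexive (macaulayBound≡bound ε))) v∈)

    module Γ = Graded segment segment-deg (λ d → Unique.take⁺ (g d) (monomials-unique (suc (g 1)) d))

    homogenise : ℕ → Vec ℕ (suc (g 1)) → Vec ℕ (suc (suc (g 1)))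
    homogenise i v = i ∸ deg v ∷ v

    -- The cut-off at `e` matters because `g` is controlled only up to degree `e`. In degrees beyond
    -- `e` the same monomials reappear, padded with powers of the new variable.
    slice : ℕ → List (Vec ℕ (suc (suc (g 1))))
    slice i = map (homogenise i) (Γ.upTo (i ⊓ e))

    slice-deg : ∀ i {v} → v ∈ slice i → deg v ≡ i
    slice-deg i v∈ with w , w∈ , refl ← ∈-map⁻ (homogenise i) v∈ =
      m∸n+n≡m (≤-trans (proj₁ (Γ.∈-upTo⁻ (i ⊓ e) w∈)) (m⊓n≤m i e))

    module S = Graded slice slice-deg (λ i → Unique.map⁺ Vec.∷-injectiveʳ (Γ.upTo-unique (i ⊓ e)))

    -- The smaller of the two numbers whose half, rounded down, is `e`.
    E : ℕ
    E = e * 2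

    X : List (Vec ℕ (suc (suc (g 1))))
    X = S.upTo E

    InX : Vec ℕ (suc (suc (g 1))) → Set
    InX (a ∷ w) = a + deg w ≤ E × deg w ≤ e × w ∈ segment (deg w)

    ∈-X⁺ : ∀ v → InX v → v ∈ X
    ∈-X⁺ (a ∷ w) (≤E , ≤e , w∈) = S.∈-upTo⁺ E ≤E (subst (_∈ slice (a + deg w)) (cong (_∷ w) (m+n∸n≡m a (deg w)))
      (∈-map⁺ (homogenise (a + deg w)) (Γ.∈-upTo⁺ ((a + deg w) ⊓ e) (⊓-glb (m≤n+m (deg w) a) ≤e) w∈)))

    ∈-X⁻ : ∀ v → v ∈ X → InX v
    ∈-X⁻ (a ∷ w) v∈ with S.∈-upTo⁻ E v∈
    ... | ≤E , v∈slice with _ , w∈ , eq ← ∈-map⁻ (homogenise (a + deg w)) v∈slice with refl ← Vec.∷-injectiveʳ eq =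
      ≤E , ≤-trans (proj₁ (Γ.∈-upTo⁻ _ w∈)) (m⊓n≤n (a + deg w) e) , proj₂ (Γ.∈-upTo⁻ ((a + deg w) ⊓ e) w∈)

    InX-down : ∀ v i → InX (updateAt v i suc) → InX v
    InX-down (a ∷ w) zero    (≤E , ≤e , w∈) = <⇒≤ ≤E , ≤e , w∈
    InX-down (a ∷ w) (suc i) (≤E , ≤e , w∈) rewrite deg-updateAt-suc w i =
      ≤-trans (+-monoʳ-≤ a (n≤1+n (deg w))) ≤E , <⇒≤ ≤e , segment-down (deg w) ≤e w i w∈

    X-pure : IsPureOrderIdeal X E
    X-pure = (S.upTo-unique E , nonempty , λ M N M∈ N≤M → ∈-X⁺ N (∣ₘ-closed InX InX-down N M N≤M (∈-X⁻ M M∈))) , maximal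
      where
      nonempty : X ≢ []
      nonempty eq with subst (homogenise 0 (replicate (suc (g 1)) 0) ∈_) eq (S.∈-upTo⁺ E z≤deg in-slice)
        where
        deg0 : deg (replicate (suc (g 1)) 0) ≡ 0
        deg0 = monomials-deg (suc (g 1)) 0 (here refl)
        v = homogenise 0 (replicate (suc (g 1)) 0)
        deg-v : deg v ≡ 0
        deg-v = cong₂ _+_ (0∸n≡0 (deg (replicate (suc (g 1)) 0))) deg0
        z≤deg : deg v ≤ E
        z≤deg = ≤-trans (≤-reflexive deg-v) z≤n
        in-slice : v ∈ slice (deg v)
        in-slice rewrite deg-v = ∈-map⁺ (homogenise 0) (subst (λ k → replicate (suc (g 1)) 0 ∈ take k (monomials (suc (g 1)) 0)) (sym g0) (here refl))
      ... | ()
      maximal : ∀ M → IsMaximal X M → deg M ≡ E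
      maximal (a ∷ w) (M∈ , max) with ∈-X⁻ (a ∷ w) M∈
      ... | ≤E , ≤e , w∈ with a + deg w ≟ E
      ...   | yes eq = eq
      -- Below degree `E` one more factor of the new variable stays in `X`, so the monomial was not
      -- maximal.
      ...   | no  ne with () ← max (suc a ∷ w) (∈-X⁺ (suc a ∷ w) (≤∧≢⇒< ≤E ne , ≤e , w∈)) (∣ₘ-updateAt-suc (a ∷ w) zero)

    countDeg-X : ∀ i → i ≤ e → countDeg X i ≡ length (Γ.upTo i)
    countDeg-X i i≤e = trans (S.countDeg-upTo E i (≤-trans i≤e (m≤m*n e 2)))
      (trans (length-map (homogenise i) (Γ.upTo (i ⊓ e))) (cong (λ k → length (Γ.upTo k)) (m≤n⇒m⊓n≡m i≤e)))

    length-upTo-suc : ∀ i → suc i ≤ e → length (Γ.upTo (suc i)) ≡ g (suc i) + length (Γ.upTo i)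
    length-upTo-suc i i<e = trans (length-++ (segment (suc i))) (cong (_+ length (Γ.upTo i)) (length-segment (suc i) i<e))

  -- Vector entries and the two implications.

  get-toℕ : ∀ {n} (v : Vec ℕ n) i → get v (toℕ i) ≡ lookup v i
  get-toℕ (x ∷ v) zero    = refl
  get-toℕ (x ∷ v) (suc i) = get-toℕ v i

  get-lookup : ∀ {n} (v : Vec ℕ n) {i} (i<n : i < n) → get v i ≡ lookup v (fromℕ< i<n)
  get-lookup v i<n = trans (cong (get v) (sym (Fin.toℕ-fromℕ< i<n))) (get-toℕ v (fromℕ< i<n))

  get-tabulate : ∀ {n} (f : Fin n → ℕ) {i} (i<n : i < n) → get (tabulate f) i ≡ f (fromℕ< i<n)
  get-tabulate f i<n = trans (get-lookup (tabulate f) i<n) (Vec.lookup∘tabulate f (fromℕ< i<n))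

  get-Δ-suc : ∀ {e} (h : Vec ℕ (suc e)) {i} → i < e → get (Δ h) (suc i) ≡ get h (suc i) ∸ get h i
  get-Δ-suc h {i} i<e = trans (get-tabulate (λ j → get h (suc (toℕ j)) ∸ get h (toℕ j)) i<e)
    (cong (λ j → get h (suc j) ∸ get h j) (Fin.toℕ-fromℕ< i<e))

  first-half⇒differentiable : ∀ {e} (h : Vec ℕ (suc e)) → get h 0 ≡ 1 → IsFirstHalfOfPure h → Differentiable h
  first-half⇒differentiable {e} h h0 (E , H , (r , X , pure , counts) , half , H≡h) = mono , h0 , growth
    where
    open PureOrderIdeal X E pure
    e*2≤E : e * 2 ≤ E
    e*2≤E = subst (λ k → k * 2 ≤ E) half (m/n*n≤m E 2)
    count≡ : ∀ i → i ≤ e → countDeg X i ≡ get h i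
    count≡ i i≤e = trans (cong (countDeg X) (sym (Fin.toℕ-fromℕ< i<))) (trans (counts (fromℕ< i<))
      (trans (sym (get-lookup H i<)) (H≡h i i≤e)))
      where
      i< : i < suc E
      i< = s≤s (≤-trans i≤e (≤-trans (m≤m*n e 2) e*2≤E))
    -- Since `e` is half of `E` rounded down, all degrees below `e` lie in the range where
    -- multiplication by ℓ is injective.
    double< : ∀ {d} → d < e → d + d < E
    double< {d} d<e = <-≤-trans (+-mono-< d<e d<e) (≤-trans (≤-reflexive (trans (cong (_+_ e) (sym (+-identityʳ e))) (*-comm 2 e))) e*2≤E)
    mono : ∀ i → i < e → get h i ≤ get h (suc i)
    mono i i<e = subst₂ _≤_ (count≡ i (<⇒≤ i<e)) (count≡ (suc i) i<e) (countDeg-mono i (double< i<e))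
    growth : ∀ d → 1 ≤ d → d < e → get (Δ h) (suc d) ≤ macaulayBound d (get (Δ h) d)
    growth (suc d) _ d<e = subst₂ (λ x y → x ≤ macaulayBound (suc d) y)
      (trans (cong₂ _∸_ (count≡ (suc (suc d)) d<e) (count≡ (suc d) (<⇒≤ d<e))) (sym (get-Δ-suc h d<e)))
      (trans (cong₂ _∸_ (count≡ (suc d) (<⇒≤ d<e)) (count≡ d (<⇒≤ (<⇒≤ d<e)))) (sym (get-Δ-suc h (<⇒≤ d<e))))
      (difference-macaulay d (double< (<⇒≤ d<e)))

  differentiable⇒first-half : ∀ {e} (h : Vec ℕ (suc e)) → Differentiable h → IsFirstHalfOfPure h
  differentiable⇒first-half {e} h (mono , Δ0 , growth) =
      E , tabulate (λ i → countDeg X (toℕ i)) ,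
      (_ , X , X-pure , λ i → sym (Vec.lookup∘tabulate (λ i → countDeg X (toℕ i)) i)) , m*n/n≡m e 2 , agree
    where
    open Construction e (get (Δ h)) Δ0 growth
    cumulative : ∀ i → i ≤ e → length (Γ.upTo i) ≡ get h i
    cumulative zero    i≤e = length-segment 0 z≤n
    cumulative (suc i) i<e = trans (length-upTo-suc i i<e)
      (trans (cong₂ _+_ (get-Δ-suc h i<e) (cumulative i (<⇒≤ i<e))) (m∸n+n≡m (mono i i<e)))
    agree : ∀ i → i ≤ e → get (tabulate {n = suc E} (λ j → countDeg X (toℕ j))) i ≡ get h i
    agree i i≤e = trans (get-tabulate (λ j → countDeg X (toℕ j)) i<)
      (trans (cong (countDeg X) (Fin.toℕ-fromℕ< i<)) (trans (countDeg-X i i≤e) (cumulative i i≤e)))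
      where
      i< : i < suc E
      i< = s≤s (≤-trans i≤e (m≤m*n e 2))

open FirstHalves

theorem3p1 : (e : ℕ) (h : Vec ℕ (suc e)) → IsOSequence h →
    (IsFirstHalfOfPure h → Differentiable h) × (Differentiable h → IsFirstHalfOfPure h)
theorem3p1 e h (h0 , _) = first-half⇒differentiable h h0 , differentiable⇒first-half h
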